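{- Let $q$ be a prime power, $n$ a positive integer, and let $f\in\mathcal{L}_{n,q}$ be a $q$-polynomial over $\mathbb{F}_{q^n}$. If $f$ is a low weight polynomial, then $(\mathbb{S}_f,+,\cdot)$ is a field, where $+$ and $\cdot$ are the usual sum and product of matrices.
   Context: $\mathcal{L}_{n,q}$ is the set of $q$-polynomials (linearized polynomials) $\sum_{i=0}^{n-1}a_ix^{q^i}$ with $a_i\in\mathbb{F}_{q^n}$, identified with the $\mathbb{F}_q$-linear endomorphisms of $\mathbb{F}_{q^n}$. The graph of $f$ is $\mathcal{G}_f=\{(y,f(y)) : y\in\mathbb{F}_{q^n}\}\subseteq \mathrm{AG}(2,q^n)=\mathbb{F}_{q^n}^2$. The polynomial $f$ is a low weight polynomial if $|\ell\cap\mathcal{G}_f|<q^{n/2}$ for every affine line $\ell$ of $\mathrm{AG}(2,q^n)$. The set $\mathbb{S}_f=\{A\in\mathbb{F}_{q^n}^{2\times 2} : A\mathcal{G}_f\subseteq\mathcal{G}_f\}$, where $A\mathcal{G}_f=\left\{A\begin{pmatrix}y\\ f(y)\end{pmatrix} : y\in\mathbb{F}_{q^n}\right\}$ (row and column vectors being identified). -}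

module Defs where

open import Algebra.Bundles using (CommutativeRing)
open import Algebra.Core using (Op₁; Op₂)
import Algebra.Properties.Monoid.Sum as MonoidSum
import Algebra.Properties.Semiring.Exp as SemiringExp
open import Algebra.Structures using (IsCommutativeRing)
open import Data.Fin.Base using (Fin; toℕ)
open import Data.Nat.Base as ℕ using (ℕ)
open import Data.Nat.Primality using (Prime)
open import Data.Product.Base using (Σ; ∃; ∃₂; _×_; _,_; proj₁)
open import Data.Vec.Functional using (Vector; []; _∷_; zipWith; map; replicate)
import Data.Vec.Functional.Relation.Binary.Equality.Setoid as VecEq
open import Function.Bundles using (Inverse)
open import Level using (Level; suc; _⊔_)
open import Relation.Binary.Bundles using (Setoid)
open import Relation.Binary.Core using (Rel)
import Relation.Binary.Construct.On as On
open import Relation.Binary.PropositionalEquality.Core using (_≡_)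
import Relation.Binary.PropositionalEquality.Properties as ≡
open import Relation.Nullary.Negation.Core using (¬_)
open import Relation.Unary using (Pred; _∈_; _⊆′_; _∩_)

IsPrimePower : ℕ → Set
IsPrimePower q = ∃₂ λ p e → Prime p × 1 ℕ.≤ e × q ≡ p ℕ.^ e

subsetSetoid : ∀ {a ℓ s} (X : Setoid a ℓ) → Pred (Setoid.Carrier X) s → Setoid (a ⊔ s) ℓ
subsetSetoid X S = On.setoid {B = Σ (Setoid.Carrier X) S} X proj₁

HasCardinality : ∀ {a ℓ} → Setoid a ℓ → ℕ → Set (a ⊔ ℓ)
HasCardinality X k = Inverse X (≡.setoid (Fin k))

record IsField {a ℓ} {A : Set a} (_≈_ : Rel A ℓ) (_+_ _*_ : Op₂ A) (-_ : Op₁ A) (0# 1# : A) : Set (a ⊔ ℓ) where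
  field
    isCommutativeRing : IsCommutativeRing _≈_ _+_ _*_ -_ 0# 1#
    1≉0               : ¬ (1# ≈ 0#)
    inverse           : ∀ x → ¬ (x ≈ 0#) → ∃ λ y → (x * y) ≈ 1#

record Field c ℓ : Set (suc (c ⊔ ℓ)) where
  field
    Carrier : Set c
    _≈_     : Rel Carrier ℓ
    _+_ _*_ : Op₂ Carrier
    -_      : Op₁ Carrier
    0# 1#   : Carrier
    isField : IsField _≈_ _+_ _*_ -_ 0# 1#

  open IsField isField public using (isCommutativeRing; 1≉0; inverse)

  commutativeRing : CommutativeRing c ℓ
  commutativeRing = record { isCommutativeRing = isCommutativeRing }

restrict : ∀ {a s} {A : Set a} (_∙_ : Op₂ A) (S : Pred A s) →
           (∀ x y → x ∈ S → y ∈ S → (x ∙ y) ∈ S) → Op₂ (Σ A S)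
restrict _∙_ S closed (x , x∈S) (y , y∈S) = (x ∙ y) , closed x y x∈S y∈S

record SubsetIsField {a ℓ s} (X : Setoid a ℓ) (_+_ _*_ : Op₂ (Setoid.Carrier X))
                     (S : Pred (Setoid.Carrier X) s) : Set (a ⊔ ℓ ⊔ s) where
  field
    +-closed : ∀ x y → x ∈ S → y ∈ S → (x + y) ∈ S
    *-closed : ∀ x y → x ∈ S → y ∈ S → (x * y) ∈ S
    neg      : Op₁ (Σ (Setoid.Carrier X) S)
    zer one  : Σ (Setoid.Carrier X) S
    isField  : IsField (Setoid._≈_ (subsetSetoid X S))
                       (restrict _+_ S +-closed) (restrict _*_ S *-closed) neg zer one

module Geometry {c ℓ} (K : Field c ℓ) where

  open CommutativeRing (Field.commutativeRing K) public
    using (Carrier; _≈_; _+_; _*_; 0#; setoid; +-monoid; semiring)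
  open MonoidSum +-monoid using (sum)
  open SemiringExp semiring using (_^_)
  open VecEq setoid using (_≋_; ≋-setoid)

  Point : Set c
  Point = Vector Carrier 2

  pointSetoid : Setoid c ℓ
  pointSetoid = ≋-setoid 2

  _+ᵥ_ : Op₂ Point
  _+ᵥ_ = zipWith _+_

  _∙ᵥ_ : Carrier → Point → Point
  t ∙ᵥ v = map (t *_) v

  Matrix : Set c
  Matrix = Vector (Vector Carrier 2) 2

  matrixSetoid : Setoid c ℓ
  matrixSetoid = VecEq.≋-setoid pointSetoid 2

  _+ₘ_ : Op₂ Matrix
  (A +ₘ B) i j = A i j + B i j

  _*ₘ_ : Op₂ Matrix
  (A *ₘ B) i j = sum λ k → A i k * B k j

  _*ᵥ_ : Matrix → Point → Point
  (A *ᵥ v) i = sum λ k → A i k * v k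

  -- The vector a is the list of coefficients of Σ_{i<n} a_i x^(q^i).
  QPolynomial : ℕ → Set c
  QPolynomial n = Vector Carrier n

  eval : ∀ {n} (q : ℕ) → QPolynomial n → Carrier → Carrier
  eval q a x = sum λ i → a i * (x ^ (q ℕ.^ toℕ i))

  Graph : (Carrier → Carrier) → Pred Point (c ⊔ ℓ)
  Graph f P = ∃ λ y → P ≋ (y ∷ f y ∷ [])

  record AffineLine : Set (c ⊔ ℓ) where
    field
      base        : Point
      direction   : Point
      direction≉0 : ¬ (direction ≋ replicate 2 0#)

  OnLine : AffineLine → Pred Point (c ⊔ ℓ)
  OnLine l P = ∃ λ t → P ≋ (base +ᵥ (t ∙ᵥ direction))
    where open AffineLine l

  -- The bound |l ∩ G_f| < q^(n/2) is squared to stay in ℕ.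
  LowWeight : ∀ {n} (q : ℕ) → QPolynomial n → Set (c ⊔ ℓ)
  LowWeight {n} q a =
    ∀ (l : AffineLine) → ∃ λ k →
      HasCardinality (subsetSetoid pointSetoid (OnLine l ∩ Graph (eval q a))) k
      × k ℕ.^ 2 ℕ.< q ℕ.^ n

  image : Matrix → Pred Point (c ⊔ ℓ) → Pred Point (c ⊔ ℓ)
  image A S P = ∃ λ Q → Q ∈ S × P ≋ (A *ᵥ Q)

  𝕊 : ∀ {n} (q : ℕ) → QPolynomial n → Pred Matrix (c ⊔ ℓ)
  𝕊 q a A = image A (Graph (eval q a)) ⊆′ Graph (eval q a)

{-# OPTIONS --safe #-}
-- f is additive, so a matrix A lies in S iff f(A₀(y, f y)) = A₁(y, f y) for all y, and S is a ring.
-- A singular A ∈ S other than 0 maps the graph into one line with fibres inside translates of another,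
-- so that q^n < q^(n/2) q^(n/2); hence nonzero elements of S are invertible, and A being injective on the
-- finite graph, A⁻¹ is again in S.
--
-- Commutativity is elementary for 2×2 matrices and does not need Wedderburn's theorem. A traceless C ∈ S
-- satisfies C² = Q(C) with Q(C) = -det C, and Q(C) lies in the finite set k of scalars belonging to S. For
-- nonzero traceless C, X ∈ S with tr(CX) = 0, counting squares gives v, w ∈ k with v² Q(C) + w² Q(X) = 1;
-- then Y = vC + wX is traceless with Y² = 1, so Y - 1 is singular and Y = 1.
-- Suppose C = [A, B] ≠ 0. In odd characteristic take X = [C, A]: either X = 0 and
-- 2Q(C) = tr(C[A, B]) = tr([C, A]B) = 0, or Y = 1 has trace 2 ≠ 0. In characteristic 2 take X = C: then C is
-- scalar, and so is [A, AB] = AC, so A is scalar and C = 0.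
module Submission where

open import Defs
open import Algebra.Bundles using (CommutativeRing)
import Algebra.Properties.AbelianGroup as AbelianGroupProperties
import Algebra.Properties.CommutativeMonoid.Sum as CommutativeMonoidSum
import Algebra.Properties.CommutativeSemiring.Binomial as Binomial
import Algebra.Properties.Group as GroupProperties
import Algebra.Properties.Ring as RingProperties
import Algebra.Properties.Semiring.Exp as SemiringExp
import Algebra.Properties.Semiring.Mult as SemiringMult
import Algebra.Properties.Semiring.Mult.TCOptimised as SemiringMult′
import Algebra.Solver.Ring as RingSolver
open import Algebra.Solver.Ring.AlmostCommutativeRing using (fromCommutativeRing; _-Raw-AlmostCommutative⟶_)
open import Data.Bool.Base using (Bool; true; false)
open import Data.Empty using (⊥)
open import Data.Fin.Base as Fin using (Fin; zero; suc; toℕ; fromℕ; inject₁; combine; punchOut)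
open import Data.Fin.Patterns using (0F; 1F)
import Data.Fin.Permutation as Permutation
import Data.Fin.Properties as Fin
open import Data.Integer.Base as ℤ using (ℤ; +_; -[1+_])
import Data.Integer.Properties as ℤ
open import Data.Maybe.Base as Maybe using (Maybe)
open import Data.Nat.Base as ℕ using (ℕ; zero; suc; _≤_; _<_; _^_; _!)
open import Data.Nat.Combinatorics using (nCn≡1; nCk≡n!/k![n-k]!; k![n∸k]!∣n!) renaming (_C_ to _choose_)
open import Data.Nat.DivMod using (m/n*n≡m)
open import Data.Nat.Divisibility using (_∣_; divides; ∣-refl; ∣m⇒∣m*n; ∣⇒≤)
open import Data.Nat.Primality using (Prime; euclidsLemma; ¬prime[0]; ¬prime[1])
import Data.Nat.Properties as ℕ
open import Data.Nat.Solver using (module +-*-Solver)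
open import Data.Product.Base as Product using (∃; ∃₂; Σ; _×_; _,_; proj₁; proj₂)
open import Data.Product.Function.NonDependent.Setoid using (_×-inverse_)
open import Data.Product.Relation.Binary.Pointwise.NonDependent using (_×ₛ_; Pointwise-≡↔≡)
open import Data.Sum.Base using (_⊎_; inj₁; inj₂; reduce)
open import Data.Vec.Functional using ([]; _∷_; replicate)
open import Function.Base using (_∘_; _$_)
open import Function.Bundles using (Inverse)
import Function.Construct.Composition as Composition
import Function.Construct.Symmetry as Symmetry
open import Function.Definitions using (Injective)
open import Level using (_⊔_)
open import Relation.Binary.Bundles using (Setoid)
open import Relation.Binary.Definitions using (Decidable; _Respects_; tri<; tri≈; tri>)
open import Relation.Binary.PropositionalEquality as ≡ using (_≡_)
import Relation.Binary.Reasoning.Setoid as ≈-Reasoning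
open import Relation.Nullary.Decidable using (Dec; yes; no; does; dec-true; dec-false; dec⇒maybe; decidable-stable; map′)
open import Relation.Nullary.Negation using (¬_; contradiction)
open import Relation.Unary using (Pred; _∩_; _⊆′_)
import Relation.Unary as Unary

-- Ring solver with integer coefficients.

module IntegerCoefficientSolver {c ℓ} (R : CommutativeRing c ℓ) where

  open CommutativeRing R
  open SemiringMult′ semiring using (×-homo-+; ×1-homo-*; 1+×) renaming (_×_ to _×ₘ_)
  open RingProperties ring using (-‿distribˡ-*; -‿distribʳ-*; -0#≈0#; -‿involutive)
  open AbelianGroupProperties +-abelianGroup using (⁻¹-∙-comm)
  open ≈-Reasoning setoid

  -- The multiple `_×ₘ_` is the variant with `1 ×ₘ 1#` equal to `1#` by computation, so that `:1` in
  -- a solver equation denotes `1#` itself.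
  fromℤ : ℤ → Carrier
  fromℤ (+ n)    = n ×ₘ 1#
  fromℤ -[1+ n ] = - (suc n ×ₘ 1#)

  fromℤ-neg : ∀ i → fromℤ (ℤ.- i) ≈ - fromℤ i
  fromℤ-neg (+ zero)   = sym -0#≈0#
  fromℤ-neg (+ suc n)  = refl
  fromℤ-neg (-[1+ n ]) = sym (-‿involutive _)

  x+y-[x+z]≈y-z : ∀ x y z → (x + y) - (x + z) ≈ y - z
  x+y-[x+z]≈y-z x y z = begin
    (x + y) - (x + z)       ≈⟨ +-congˡ (sym (⁻¹-∙-comm x z)) ⟩
    (x + y) + (- x + - z)   ≈⟨ +-congʳ (+-comm x y) ⟩
    (y + x) + (- x + - z)   ≈⟨ +-assoc y x _ ⟩
    y + (x + (- x + - z))   ≈⟨ +-congˡ (+-assoc x (- x) _) ⟨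
    y + ((x + - x) + - z)   ≈⟨ +-congˡ (+-congʳ (-‿inverseʳ x)) ⟩
    y + (0# + - z)          ≈⟨ +-congˡ (+-identityˡ _) ⟩
    y - z                   ∎

  fromℤ-⊖ : ∀ m n → fromℤ (m ℤ.⊖ n) ≈ (m ×ₘ 1#) - (n ×ₘ 1#)
  fromℤ-⊖ m zero = begin
    m ×ₘ 1#         ≈⟨ +-identityʳ _ ⟨
    m ×ₘ 1# + 0#    ≈⟨ +-congˡ -0#≈0# ⟨
    m ×ₘ 1# - 0#    ∎
  fromℤ-⊖ zero    (suc n) = sym (+-identityˡ _)
  fromℤ-⊖ (suc m) (suc n) = begin
    fromℤ (suc m ℤ.⊖ suc n)               ≡⟨ ≡.cong fromℤ (ℤ.[1+m]⊖[1+n]≡m⊖n m n) ⟩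
    fromℤ (m ℤ.⊖ n)                       ≈⟨ fromℤ-⊖ m n ⟩
    m ×ₘ 1# - n ×ₘ 1#                       ≈⟨ x+y-[x+z]≈y-z 1# _ _ ⟨
    (1# + m ×ₘ 1#) - (1# + n ×ₘ 1#)         ≈⟨ +-cong (1+× m 1#) (-‿cong (1+× n 1#)) ⟨
    suc m ×ₘ 1# - suc n ×ₘ 1#               ∎

  fromℤ-+ : ∀ i j → fromℤ (i ℤ.+ j) ≈ fromℤ i + fromℤ j
  fromℤ-+ (+ m)    (+ n)    = ×-homo-+ 1# m n
  fromℤ-+ (+ m)    -[1+ n ] = fromℤ-⊖ m (suc n)
  fromℤ-+ -[1+ m ] (+ n)    = trans (fromℤ-⊖ n (suc m)) (+-comm _ _)
  fromℤ-+ -[1+ m ] -[1+ n ] = begin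
    fromℤ (-[1+ m ] ℤ.+ -[1+ n ])         ≡⟨ ≡.cong fromℤ (ℤ.neg-distrib-+ (+ suc m) (+ suc n)) ⟨
    - ((suc m ℕ.+ suc n) ×ₘ 1#)            ≈⟨ -‿cong (×-homo-+ 1# (suc m) (suc n)) ⟩
    - (suc m ×ₘ 1# + suc n ×ₘ 1#)           ≈⟨ ⁻¹-∙-comm _ _ ⟨
    - (suc m ×ₘ 1#) + - (suc n ×ₘ 1#)       ∎

  fromℤ-*-+ : ∀ i n → fromℤ (i ℤ.* + n) ≈ fromℤ i * fromℤ (+ n)
  fromℤ-*-+ (+ m)    n = trans (reflexive (≡.cong fromℤ (≡.sym (ℤ.pos-* m n)))) (×1-homo-* m n)
  fromℤ-*-+ -[1+ m ] n = begin
    fromℤ (-[1+ m ] ℤ.* + n)          ≡⟨ ≡.cong fromℤ (ℤ.neg-distribˡ-* (+ suc m) (+ n)) ⟨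
    fromℤ (ℤ.- (+ suc m ℤ.* + n))     ≈⟨ fromℤ-neg (+ suc m ℤ.* + n) ⟩
    - fromℤ (+ suc m ℤ.* + n)         ≈⟨ -‿cong (fromℤ-*-+ (+ suc m) n) ⟩
    - (suc m ×ₘ 1# * n ×ₘ 1#)           ≈⟨ -‿distribˡ-* _ _ ⟩
    - (suc m ×ₘ 1#) * n ×ₘ 1#           ∎

  fromℤ-* : ∀ i j → fromℤ (i ℤ.* j) ≈ fromℤ i * fromℤ j
  fromℤ-* i (+ n)    = fromℤ-*-+ i n
  fromℤ-* i -[1+ n ] = begin
    fromℤ (i ℤ.* -[1+ n ])            ≡⟨ ≡.cong fromℤ (ℤ.neg-distribʳ-* i (+ suc n)) ⟨
    fromℤ (ℤ.- (i ℤ.* + suc n))       ≈⟨ fromℤ-neg (i ℤ.* + suc n) ⟩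
    - fromℤ (i ℤ.* + suc n)           ≈⟨ -‿cong (fromℤ-*-+ i (suc n)) ⟩
    - (fromℤ i * suc n ×ₘ 1#)          ≈⟨ -‿distribʳ-* _ _ ⟩
    fromℤ i * - (suc n ×ₘ 1#)          ∎

  fromℤ-homomorphism : ℤ.+-*-rawRing -Raw-AlmostCommutative⟶ fromCommutativeRing R
  fromℤ-homomorphism = record
    { ⟦_⟧    = fromℤ
    ; +-homo = fromℤ-+
    ; *-homo = fromℤ-*
    ; -‿homo = fromℤ-neg
    ; 0-homo = refl
    ; 1-homo = refl
    }

  fromℤ-≟ : ∀ i j → Maybe (fromℤ i ≈ fromℤ j)
  fromℤ-≟ i j = Maybe.map (λ i≡j → reflexive (≡.cong fromℤ i≡j)) (dec⇒maybe (i ℤ.≟ j))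

  open RingSolver ℤ.+-*-rawRing (fromCommutativeRing R) fromℤ-homomorphism fromℤ-≟ public
    using (solve; _:=_; con; _:+_; _:*_; _:-_; :-_; Polynomial)

  :0 :1 : ∀ {m} → Polynomial m
  :0 = con (+ 0)
  :1 = con (+ 1)

-- Prime divisors of factorials and binomial coefficients.

prime∣!⇒≤ : ∀ {p} → Prime p → ∀ m → p ∣ m ! → p ≤ m
prime∣!⇒≤ {zero}        pr m    p∣m! = ℕ.z≤n
prime∣!⇒≤ {suc zero}    pr m    p∣m! = contradiction pr ¬prime[1]
prime∣!⇒≤ {suc (suc _)} pr zero p∣1  = contradiction (∣⇒≤ p∣1) λ { (ℕ.s≤s ()) }
prime∣!⇒≤ pr (suc m) p∣m! with euclidsLemma (suc m) (m !) pr p∣m!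
... | inj₁ p∣1+m = ∣⇒≤ p∣1+m
... | inj₂ p∣m!′ = ℕ.m≤n⇒m≤1+n (prime∣!⇒≤ pr m p∣m!′)

-- p divides p!, the product of the binomial coefficient with k! and (p - k)!. By `prime∣!⇒≤` it
-- divides neither factorial, since k and p - k are smaller than p.
prime∣choose : ∀ {p k} → Prime p → 0 ℕ.< k → k ℕ.< p → p ∣ p choose k
prime∣choose {zero}      pr 0<k ()
prime∣choose {p@(suc p-1)} {k} pr 0<k k<p
  with euclidsLemma (p choose k) (k ! ℕ.* (p ℕ.∸ k) !) pr (≡.subst (p ∣_) p!≡ (∣m⇒∣m*n (p-1 !) ∣-refl))
  where
  instance _ = k ℕ.!* (p ℕ.∸ k) !≢0
  p!≡ : p ! ≡ (p choose k) ℕ.* (k ! ℕ.* (p ℕ.∸ k) !)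
  p!≡ = ≡.sym (≡.trans (≡.cong (ℕ._* (k ! ℕ.* (p ℕ.∸ k) !)) (nCk≡n!/k![n-k]! (ℕ.<⇒≤ k<p))) (m/n*n≡m (k![n∸k]!∣n! (ℕ.<⇒≤ k<p))))
... | inj₁ p∣pCk = p∣pCk
... | inj₂ p∣k!*[p∸k]! with euclidsLemma (k !) ((p ℕ.∸ k) !) pr p∣k!*[p∸k]!
...   | inj₁ p∣k!     = contradiction (prime∣!⇒≤ pr k p∣k!) (ℕ.<⇒≱ k<p)
...   | inj₂ p∣[p∸k]! = contradiction (prime∣!⇒≤ pr (p ℕ.∸ k) p∣[p∸k]!) (ℕ.<⇒≱ (ℕ.∸-monoʳ-< 0<k (ℕ.<⇒≤ k<p)))

-- Counting in finite sets.

-- An element i is determined by its value `α i` and its position `β i j` relative to a reference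
-- point j of the same fibre. Positions can be compared only for a common j, so each fibre needs a
-- representative that depends on its value alone.
fibre-bound : ∀ {n k m} (α : Fin n → Fin k) (β : ∀ i j → α i ≡ α j → Fin m) →
  (∀ {i i′ j} e e′ → β i j e ≡ β i′ j e′ → i ≡ i′) → n ≤ k ℕ.* m
fibre-bound {n} {k} {m} α β β-injective = Fin.injective⇒≤ encode-injective
  where
  Fibre : Fin k → Set
  Fibre a = ∃ λ j → a ≡ α j

  -- The last clause cannot be reached, as the given point refutes the negative answer; in the
  -- first, the result is independent of that point.
  chosen : ∀ {a} → Fibre a → Dec (Fibre a) → Fibre a
  chosen _ (yes j) = j
  chosen j (no _)  = j

  chosen-irrelevant : ∀ {a} (x y : Fibre a) d → proj₁ (chosen x d) ≡ proj₁ (chosen y d)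
  chosen-irrelevant x y (yes _) = ≡.refl
  chosen-irrelevant x y (no ¬x) = contradiction x ¬x

  fibre? : ∀ a → Dec (Fibre a)
  fibre? a = Fin.any? λ j → a Fin.≟ α j

  representative : ∀ i → Fibre (α i)
  representative i = chosen (i , ≡.refl) (fibre? (α i))

  representative-cong : ∀ {i i′} → α i ≡ α i′ → proj₁ (representative i) ≡ proj₁ (representative i′)
  representative-cong {i} {i′} eq = go (i , ≡.refl) (i′ , ≡.refl) eq
    where
    go : ∀ {a a′} (x : Fibre a) (x′ : Fibre a′) → a ≡ a′ →
         proj₁ (chosen x (fibre? a)) ≡ proj₁ (chosen x′ (fibre? a′))
    go x x′ ≡.refl = chosen-irrelevant x x′ (fibre? _)

  encode : Fin n → Fin (k ℕ.* m)
  encode i = combine (α i) (β i (proj₁ (representative i)) (proj₂ (representative i)))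

  encode-injective : Injective _≡_ _≡_ encode
  encode-injective {i} {i′} eq with Fin.combine-injective (α i) _ (α i′) _ eq
  ... | αi≡αi′ , βi≡βi′ = go (proj₂ (representative i)) (proj₂ (representative i′)) (representative-cong αi≡αi′) βi≡βi′
    where
    -- The two representatives are abstracted to j and j′ so that their equality can be matched
    -- against `≡.refl`.
    go : ∀ {j j′} (e : α i ≡ α j) (e′ : α i′ ≡ α j′) → j ≡ j′ → β i j e ≡ β i′ j′ e′ → i ≡ i′
    go e e′ ≡.refl = β-injective e e′

-- If y were missed, removing it from the codomain would leave an injection of `Fin (suc n)` into
-- `Fin n`.
injective⇒surjective : ∀ {n} {f : Fin n → Fin n} → Injective _≡_ _≡_ f → ∀ y → ∃ λ x → f x ≡ y
injective⇒surjective {suc n} {f} f-injective y with Fin.any? (λ x → f x Fin.≟ y)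
... | yes hit = hit
... | no ¬hit = contradiction
  (Fin.injective⇒≤ {f = λ x → punchOut (missed x)} (λ {x} {x′} → f-injective ∘ Fin.punchOut-injective (missed x) (missed x′)))
  ℕ.1+n≰n
  where
  missed : ∀ x → ¬ y ≡ f x
  missed x y≡fx = ¬hit (x , ≡.sym y≡fx)

module FiniteSetoid {a ℓ} (X : Setoid a ℓ) {N : ℕ} (card : HasCardinality X N) where

  open Setoid X
  open Inverse card using (to; from; to-cong; strictlyInverseˡ; strictlyInverseʳ)

  to-injective : ∀ {x y} → to x ≡ to y → x ≈ y
  to-injective {x} {y} eq = trans (sym (strictlyInverseʳ x)) (trans (Inverse.from-cong card eq) (strictlyInverseʳ y))

  from-injective : ∀ {i j} → from i ≈ from j → i ≡ j
  from-injective {i} {j} eq = ≡.trans (≡.sym (strictlyInverseˡ i)) (≡.trans (to-cong eq) (strictlyInverseˡ j))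

  infix 4 _≟_
  _≟_ : Decidable _≈_
  x ≟ y = map′ to-injective to-cong (to x Fin.≟ to y)

  all? : ∀ {p} {P : Unary.Pred Carrier p} → P Respects _≈_ → Unary.Decidable P → Dec (∀ x → P x)
  all? resp P? = map′ (λ h x → resp (strictlyInverseʳ x) (h (to x))) (λ h i → h (from i)) (Fin.all? (P? ∘ from))

  injective-endo⇒surjective : (f : Carrier → Carrier) → (∀ {x y} → f x ≈ f y → x ≈ y) → ∀ y → ∃ λ x → f x ≈ y
  injective-endo⇒surjective f f-injective y =
    Product.map from to-injective (injective⇒surjective (from-injective ∘ f-injective ∘ to-injective) (to y))

-- Additivity of the Frobenius map.

module Frobenius {c ℓ} (R : CommutativeRing c ℓ) where

  open CommutativeRing R hiding (zero)
  open SemiringMult semiring using (×-congʳ; ×-assoc-*; ×1-homo-*) renaming (_×_ to _×ₘ_)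
  open SemiringExp semiring using (^-congˡ; ^-assocʳ) renaming (_^_ to _^ᵣ_)
  open CommutativeMonoidSum +-commutativeMonoid using (sum; sum-cong-≋; sum-init-last; sum-replicate; sum-replicate-zero; ∑-distrib-+; sum-permute)
  open Binomial commutativeSemiring using (binomialTerm; theorem)
  open ≈-Reasoning setoid

  ∣⇒×≈0 : ∀ {p m} → p ×ₘ 1# ≈ 0# → p ∣ m → ∀ x → m ×ₘ x ≈ 0#
  ∣⇒×≈0 {p} p×1≈0 (divides r ≡.refl) x = begin
    (r ℕ.* p) ×ₘ x             ≈⟨ ×-congʳ (r ℕ.* p) (*-identityˡ x) ⟨
    (r ℕ.* p) ×ₘ (1# * x)      ≈⟨ ×-assoc-* (r ℕ.* p) 1# x ⟨
    (r ℕ.* p) ×ₘ 1# * x        ≈⟨ *-congʳ (×1-homo-* r p) ⟩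
    (r ×ₘ 1#) * (p ×ₘ 1#) * x  ≈⟨ *-congʳ (*-congˡ p×1≈0) ⟩
    (r ×ₘ 1#) * 0# * x         ≈⟨ *-congʳ (zeroʳ _) ⟩
    0# * x                     ≈⟨ zeroˡ x ⟩
    0#                         ∎

  -- Every binomial coefficient strictly between the two ends is divisible by p, which annihilates
  -- the ring.
  ^p-additive : ∀ {p} → Prime p → p ×ₘ 1# ≈ 0# → ∀ x y → (x + y) ^ᵣ p ≈ x ^ᵣ p + y ^ᵣ p
  ^p-additive {zero}  pr _ x y = contradiction pr ¬prime[0]
  ^p-additive {p@(suc p-1)} pr p×1≈0 x y = begin
    (x + y) ^ᵣ p                                          ≈⟨ theorem p x y ⟩
    term zero + sum (term ∘ suc)                          ≈⟨ +-congˡ (sum-init-last (term ∘ suc)) ⟩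
    term zero + (sum (term ∘ suc ∘ inject₁) + term top)   ≈⟨ +-congˡ (+-congʳ (trans (sum-cong-≋ middle≈0) (sum-replicate-zero p-1))) ⟩
    term zero + (0# + term top)                           ≈⟨ +-cong (trans (+-identityʳ _) (*-identityˡ _)) (trans (+-identityˡ _) top≈) ⟩
    -- The binomial term of index 0 is the power of y, hence the swap.
    y ^ᵣ p + x ^ᵣ p                                       ≈⟨ +-comm _ _ ⟩
    x ^ᵣ p + y ^ᵣ p                                       ∎
    where
    term = binomialTerm x y p
    top  = fromℕ p

    middle≈0 : ∀ i → term (suc (inject₁ i)) ≈ 0#
    middle≈0 i rewrite Fin.toℕ-inject₁ i = ∣⇒×≈0 p×1≈0 (prime∣choose pr ℕ.z<s (ℕ.s<s (Fin.toℕ<n i))) _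

    top≈ : term top ≈ x ^ᵣ p
    top≈ rewrite Fin.toℕ-fromℕ p-1 | nCn≡1 p | ℕ.n∸n≡0 p-1 = trans (+-identityʳ _) (*-identityʳ _)

  Additive : (Carrier → Carrier) → Set _
  Additive f = ∀ x y → f (x + y) ≈ f x + f y

  -- Used twice: to pass from p to `q = p ^ e`, and from q to the exponents `q ^ i` occurring in f.
  ^-additive-iterate : ∀ m → Additive (_^ᵣ m) → ∀ e → Additive (_^ᵣ (m ^ e))
  ^-additive-iterate m additive zero    x y = trans (*-identityʳ _) (+-cong (sym (*-identityʳ _)) (sym (*-identityʳ _)))
  ^-additive-iterate m additive (suc e) x y = begin
    (x + y) ^ᵣ (m ℕ.* m ^ e)                     ≈⟨ ^-assocʳ (x + y) m (m ^ e) ⟨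
    ((x + y) ^ᵣ m) ^ᵣ (m ^ e)                    ≈⟨ ^-congˡ (m ^ e) (additive x y) ⟩
    (x ^ᵣ m + y ^ᵣ m) ^ᵣ (m ^ e)                 ≈⟨ ^-additive-iterate m additive e _ _ ⟩
    (x ^ᵣ m) ^ᵣ (m ^ e) + (y ^ᵣ m) ^ᵣ (m ^ e)    ≈⟨ +-cong (^-assocʳ x m (m ^ e)) (^-assocʳ y m (m ^ e)) ⟩
    x ^ᵣ (m ^ suc e) + y ^ᵣ (m ^ suc e)          ∎

  -- The sum of all elements is invariant under translation by 1.
  card×1≈0 : ∀ {N} → HasCardinality setoid N → N ×ₘ 1# ≈ 0#
  card×1≈0 {N} card = GroupProperties.∙-cancelˡ +-group (sum from) _ _ (begin
    sum from + N ×ₘ 1#                 ≈⟨ +-congˡ (sum-replicate N) ⟨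
    sum from + sum {N} (λ _ → 1#)      ≈⟨ ∑-distrib-+ from (λ _ → 1#) ⟨
    sum (λ i → from i + 1#)            ≈⟨ sum-cong-≋ (λ i → strictlyInverseʳ (from i + 1#)) ⟨
    sum (λ i → from (to (from i + 1#))) ≈⟨ sum-permute from shift ⟨
    sum from                           ≈⟨ +-identityʳ _ ⟨
    sum from + 0#                      ∎)
    where
    open Inverse card using (to; from; to-cong; strictlyInverseˡ; strictlyInverseʳ)
    shift : Permutation.Permutation N N
    shift = Permutation.permutation (λ i → to (from i + 1#)) (λ i → to (from i - 1#))
      (λ i → ≡.trans (to-cong (trans (+-congʳ (strictlyInverseʳ _)) (GroupProperties.//-rightDividesˡ +-group 1# (from i)))) (strictlyInverseˡ i))
      (λ i → ≡.trans (to-cong (trans (+-congʳ (strictlyInverseʳ _)) (GroupProperties.//-rightDividesʳ +-group 1# (from i)))) (strictlyInverseˡ i))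

-- Finite fields and the evaluation of q-polynomials.

module FiniteField {c ℓ} (K : Field c ℓ) {N : ℕ} (card : HasCardinality (CommutativeRing.setoid (Field.commutativeRing K)) N) where

  open CommutativeRing (Field.commutativeRing K) hiding (zero)
  open Field K using (1≉0; inverse)
  open Inverse card using (to; to-cong)
  open FiniteSetoid setoid card using (_≟_; to-injective)
  open IntegerCoefficientSolver (Field.commutativeRing K)
  open RingProperties ring using (x∙y⁻¹≈ε⇒x≈y; x≈y⇒x∙y⁻¹≈ε; -‿involutive; -0#≈0#)
  open Frobenius (Field.commutativeRing K)
  open SemiringMult semiring using (×-homo-1; ×1-homo-*) renaming (_×_ to _×ₘ_)
  open SemiringExp semiring using (^-congˡ) renaming (_^_ to _^ᵣ_)
  open CommutativeMonoidSum +-commutativeMonoid using (sum; sum-cong-≋; ∑-distrib-+)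
  open ≈-Reasoning setoid

  *-nonzero-cancelˡ : ∀ {x y} → ¬ x ≈ 0# → x * y ≈ 0# → y ≈ 0#
  *-nonzero-cancelˡ {x} {y} x≉0 xy≈0 with z , xz≈1 ← inverse x x≉0 = begin
    y            ≈⟨ *-identityˡ y ⟨
    1# * y       ≈⟨ *-congʳ xz≈1 ⟨
    x * z * y    ≈⟨ solve 3 (λ x y z → x :* z :* y := z :* (x :* y)) refl x y z ⟩
    z * (x * y)  ≈⟨ *-congˡ xy≈0 ⟩
    z * 0#       ≈⟨ zeroʳ z ⟩
    0#           ∎

  zero-product : ∀ {x y} → x * y ≈ 0# → x ≈ 0# ⊎ y ≈ 0#
  zero-product {x} {y} xy≈0 with x ≟ 0#
  ... | yes x≈0 = inj₁ x≈0
  ... | no  x≉0 = inj₂ (*-nonzero-cancelˡ x≉0 xy≈0)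

  x*x≈y*y⇒x≈±y : ∀ {x y} → x * x ≈ y * y → x ≈ y ⊎ x ≈ - y
  x*x≈y*y⇒x≈±y {x} {y} eq with zero-product {x - y} {x - - y} (begin
    (x - y) * (x - - y)   ≈⟨ solve 2 (λ x y → (x :- y) :* (x :- (:- y)) := x :* x :- y :* y) refl x y ⟩
    x * x - y * y         ≈⟨ x≈y⇒x∙y⁻¹≈ε eq ⟩
    0#                    ∎)
  ... | inj₁ x-y≈0 = inj₁ (x∙y⁻¹≈ε⇒x≈y x y x-y≈0)
  ... | inj₂ x+y≈0 = inj₂ (x∙y⁻¹≈ε⇒x≈y x (- y) x+y≈0)

  square≈0 : ∀ {x} → x * x ≈ 0# → x ≈ 0#
  square≈0 {x} xx≈0 = reduce (zero-product xx≈0)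

  -- There are no zero divisors among the multiples of 1. Two applications descend from `q ^ n`, the
  -- number of elements, to q and then to p.
  ^×1≈0⇒×1≈0 : ∀ m k → (m ℕ.^ k) ×ₘ 1# ≈ 0# → m ×ₘ 1# ≈ 0#
  ^×1≈0⇒×1≈0 m zero    1×1≈0 = contradiction (trans (sym (×-homo-1 1#)) 1×1≈0) 1≉0
  ^×1≈0⇒×1≈0 m (suc k) eq with zero-product (trans (sym (×1-homo-* m (m ℕ.^ k))) eq)
  ... | inj₁ m≈0  = m≈0
  ... | inj₂ mᵏ≈0 = ^×1≈0⇒×1≈0 m k mᵏ≈0

  module _ {q n : ℕ} where

    open Geometry K using (QPolynomial; eval)

    eval-cong : (f : QPolynomial n) → ∀ {x y} → x ≈ y → eval q f x ≈ eval q f y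
    eval-cong f x≈y = sum-cong-≋ λ i → *-congˡ {f i} (^-congˡ (q ℕ.^ toℕ i) x≈y)

    eval-additive : IsPrimePower q → N ≡ q ℕ.^ n → (f : QPolynomial n) → Additive (eval q f)
    eval-additive (p , e , p-prime , _ , ≡.refl) N≡qⁿ f x y = begin
      sum (λ i → f i * (x + y) ^ᵣ (q ℕ.^ toℕ i))
        ≈⟨ sum-cong-≋ (λ i → trans (*-congˡ (^-additive-iterate q ^q-additive (toℕ i) x y)) (distribˡ (f i) _ _)) ⟩
      sum (λ i → f i * x ^ᵣ (q ℕ.^ toℕ i) + f i * y ^ᵣ (q ℕ.^ toℕ i))
        ≈⟨ ∑-distrib-+ (λ i → f i * x ^ᵣ (q ℕ.^ toℕ i)) (λ i → f i * y ^ᵣ (q ℕ.^ toℕ i)) ⟩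
      eval q f x + eval q f y ∎
      where
      p×1≈0 : p ×ₘ 1# ≈ 0#
      p×1≈0 = ^×1≈0⇒×1≈0 p e (^×1≈0⇒×1≈0 q n (≡.subst (λ m → m ×ₘ 1# ≈ 0#) N≡qⁿ (card×1≈0 card)))

      ^q-additive : Additive (_^ᵣ q)
      ^q-additive = ^-additive-iterate p (^p-additive p-prime p×1≈0) e

  -- Binary quadratic forms over a finite field.

  -- Comparing positions in the enumeration separates x from -x whenever they differ. Elements with
  -- x = -x get `false`: these include 0 and, in characteristic 2, everything.
  sign : Carrier → Bool
  sign x = does (to x Fin.<? to (- x))

  sign-distinguishes-± : ∀ {x y} → x ≈ y ⊎ x ≈ - y → sign x ≡ sign y → x ≈ y
  sign-distinguishes-± (inj₁ x≈y) _ = x≈y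
  sign-distinguishes-± {x} {y} (inj₂ x≈-y) eq
    -- After rewriting, the two signs compare the positions of y and -y in opposite orders, so they
    -- agree only if these positions coincide.
    rewrite to-cong x≈-y | to-cong (trans (-‿cong x≈-y) (-‿involutive y))
    with Fin.<-cmp (to y) (to (- y))
  ... | tri≈ _ y≡-y _ = trans x≈-y (sym (to-injective y≡-y))
  ... | tri< y<-y _ -y≮y = contradiction
    (≡.trans (≡.sym (dec-false (to (- y) Fin.<? to y) -y≮y)) (≡.trans eq (dec-true (to y Fin.<? to (- y)) y<-y))) λ ()
  ... | tri> y≮-y _ -y<y = contradiction
    (≡.trans (≡.sym (dec-true (to (- y) Fin.<? to y) -y<y)) (≡.trans eq (dec-false (to y Fin.<? to (- y)) y≮-y))) λ ()

  sign-0 : ∀ {x} → x ≈ 0# → sign x ≡ false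
  sign-0 {x} x≈0 = dec-false (to x Fin.<? to (- x)) λ lt →
    Fin.<-irrefl (to-cong (trans x≈0 (trans (sym -0#≈0#) (-‿cong (sym x≈0))))) lt

  card-×Bool : HasCardinality (setoid ×ₛ ≡.setoid Bool) (N ℕ.* 2)
  card-×Bool = Composition.inverse (card ×-inverse Symmetry.inverse Fin.2↔Bool)
    (Composition.inverse Pointwise-≡↔≡ (Symmetry.inverse Fin.*↔×))

  -- In the application k consists of the scalars lying in S. Closure under 1 - x keeps
  -- `1# - b * (v * v)` inside k.
  module _ {p} {k : Pred Carrier p} (k-resp : k Respects _≈_) (k? : Unary.Decidable k)
           (0∈k : k 0#) (*-closed : ∀ {x y} → k x → k y → k (x * y)) (1-closed : ∀ {x} → k x → k (1# - x)) where

    module _ {a b} (a∈k : k a) (b∈k : k b) (a≉0 : ¬ a ≈ 0#) (b≉0 : ¬ b ≈ 0#)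
             (no-solution : ∀ v w → k v → k w → ¬ a * (v * v) + b * (w * w) ≈ 1#) where

      -- The classical count of the values a v² and 1 - b w², made into a map: an input marked
      -- `true` goes to the first family and one marked `false` to the second. Squaring identifies v
      -- with -v, so the output Boolean records `sign v`. Outside k the map is the identity, which
      -- makes it a self-map of all of K × Bool.
      φ : Carrier × Bool → Carrier × Bool
      φ (v , s) with k? v
      ... | no _ = v , s
      φ (v , true)  | yes _ = a * (v * v) , sign v
      φ (v , false) | yes _ = 1# - b * (v * v) , sign v

      unsquare : ∀ {e v w} → ¬ e ≈ 0# → e * (v * v) ≈ e * (w * w) → sign v ≡ sign w → v ≈ w
      unsquare {e} {v} {w} e≉0 eq = sign-distinguishes-± (x*x≈y*y⇒x≈±y (x∙y⁻¹≈ε⇒x≈y _ _ (*-nonzero-cancelˡ e≉0 (begin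
        e * (v * v - w * w)         ≈⟨ solve 3 (λ e v w → e :* (v :* v :- w :* w) := e :* (v :* v) :- e :* (w :* w)) refl
              e v w ⟩
        e * (v * v) - e * (w * w)   ≈⟨ x≈y⇒x∙y⁻¹≈ε eq ⟩
        0#                          ∎))))

      1-injective : ∀ {x y} → 1# - x ≈ 1# - y → x ≈ y
      1-injective {x} {y} eq = begin
        x              ≈⟨ solve 1 (λ x → x := :1 :- (:1 :- x)) refl x ⟩
        1# - (1# - x)  ≈⟨ +-congˡ (-‿cong eq) ⟩
        1# - (1# - y)  ≈⟨ solve 1 (λ x → x := :1 :- (:1 :- x)) refl y ⟨
        y              ∎

      solved : ∀ {v w} → k v → k w → ¬ a * (v * v) ≈ 1# - b * (w * w)
      solved {v} {w} v∈k w∈k eq = no-solution v w v∈k w∈k (begin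
        a * (v * v) + b * (w * w)         ≈⟨ +-congʳ eq ⟩
        1# - b * (w * w) + b * (w * w)    ≈⟨ solve 1 (λ x → :1 :- x :+ x := :1) refl (b * (w * w)) ⟩
        1#                                ∎)

      av²∈k : ∀ {v} → k v → k (a * (v * v))
      av²∈k v∈k = *-closed a∈k (*-closed v∈k v∈k)

      1-bv²∈k : ∀ {v} → k v → k (1# - b * (v * v))
      1-bv²∈k v∈k = 1-closed (*-closed b∈k (*-closed v∈k v∈k))

      -- Inside one family the sign recovers v from its square. A coincidence between the families
      -- would solve the equation, and none occurs between k and its complement, as k is closed
      -- under both formulas.
      φ-injective : ∀ {x y} → proj₁ (φ x) ≈ proj₁ (φ y) × proj₂ (φ x) ≡ proj₂ (φ y) →
                    proj₁ x ≈ proj₁ y × proj₂ x ≡ proj₂ y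
      φ-injective {v , s} {w , t} (eq , eqₛ) with k? v | k? w
      φ-injective {v , s} {w , t} (eq , eqₛ) | no _ | no _ = eq , eqₛ
      φ-injective {v , true}  {w , t} (eq , eqₛ) | yes v∈k | no w∉k = contradiction (k-resp eq (av²∈k v∈k)) w∉k
      φ-injective {v , false} {w , t} (eq , eqₛ) | yes v∈k | no w∉k = contradiction (k-resp eq (1-bv²∈k v∈k)) w∉k
      φ-injective {v , s} {w , true}  (eq , eqₛ) | no v∉k | yes w∈k = contradiction (k-resp (sym eq) (av²∈k w∈k)) v∉k
      φ-injective {v , s} {w , false} (eq , eqₛ) | no v∉k | yes w∈k = contradiction (k-resp (sym eq) (1-bv²∈k w∈k)) v∉k
      φ-injective {v , true}  {w , true}  (eq , eqₛ) | yes v∈k | yes w∈k = unsquare a≉0 eq eqₛ , ≡.refl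
      φ-injective {v , false} {w , false} (eq , eqₛ) | yes v∈k | yes w∈k = unsquare b≉0 (1-injective eq) eqₛ , ≡.refl
      φ-injective {v , true}  {w , false} (eq , eqₛ) | yes v∈k | yes w∈k = contradiction eq (solved v∈k w∈k)
      φ-injective {v , false} {w , true}  (eq , eqₛ) | yes v∈k | yes w∈k = contradiction (sym eq) (solved w∈k v∈k)

      -- 0 lies in k, so only the two families matter: a v² = 0 forces v = 0, whose sign is `false`,
      -- and 1 - b v² = 0 would be a solution with first coordinate 0.
      φ-misses-0 : ∀ x → ¬ (proj₁ (φ x) ≈ 0# × proj₂ (φ x) ≡ true)
      φ-misses-0 (v , s) (eq , eqₛ) with k? v
      φ-misses-0 (v , s)     (eq , eqₛ) | no v∉k  = v∉k (k-resp (sym eq) 0∈k)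
      φ-misses-0 (v , true)  (eq , eqₛ) | yes v∈k =
        contradiction (≡.trans (≡.sym (sign-0 (square≈0 (*-nonzero-cancelˡ a≉0 eq)))) eqₛ) λ ()
      φ-misses-0 (v , false) (eq , eqₛ) | yes v∈k = no-solution 0# v 0∈k v∈k (begin
        a * (0# * 0#) + b * (v * v)   ≈⟨ solve 2 (λ a x → a :* (:0 :* :0) :+ x := :1 :- (:1 :- x)) refl
              a (b * (v * v)) ⟩
        1# - (1# - b * (v * v))       ≈⟨ +-congˡ (-‿cong eq) ⟩
        1# - 0#                       ≈⟨ solve 0 (:1 :- :0 := :1) refl ⟩
        1#                            ∎)

    -- Without a solution, φ would be an injective self-map of the finite set K × Bool missing (0 , true).
    binary-form-represents-1 : ∀ {a b} → k a → k b → ¬ a ≈ 0# → ¬ b ≈ 0# →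
      ¬ (∀ v w → k v → k w → ¬ a * (v * v) + b * (w * w) ≈ 1#)
    binary-form-represents-1 a∈k b∈k a≉0 b≉0 no-solution =
      let x , φx≈ = FiniteSetoid.injective-endo⇒surjective (setoid ×ₛ ≡.setoid Bool) card-×Bool
                      (φ a∈k b∈k a≉0 b≉0 no-solution) (φ-injective a∈k b∈k a≉0 b≉0 no-solution) (0# , true)
      in φ-misses-0 a∈k b∈k a≉0 b≉0 no-solution x φx≈

-- The low weight condition.

-- Since √o may fail to be an integer, the bounds are compared squared: `o ≤ m * n` would give o² ≤
-- m² n² < o².
squares<⇒product< : ∀ m n {o} → m ℕ.^ 2 < o → n ℕ.^ 2 < o → m ℕ.* n < o
squares<⇒product< m n {o} m²<o n²<o = ℕ.≰⇒> λ o≤mn → ℕ.<-irrefl ≡.refl $ begin-strict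
  o ℕ.^ 2              ≤⟨ ℕ.^-monoˡ-≤ 2 o≤mn ⟩
  (m ℕ.* n) ℕ.^ 2      ≡⟨ solve 2 (λ m n → (m :* n) :^ 2 := m :^ 2 :* n :^ 2) ≡.refl m n ⟩
  m ℕ.^ 2 ℕ.* n ℕ.^ 2  <⟨ ℕ.*-mono-< m²<o n²<o ⟩
  o ℕ.* o              ≡⟨ ≡.cong (o ℕ.*_) (ℕ.*-identityʳ o) ⟨
  o ℕ.^ 2              ∎
  where
  open ℕ.≤-Reasoning
  open +-*-Solver

module _ {c ℓ} (K : Field c ℓ) where

  open Geometry K

  -- This is `LowWeight` with the polynomial replaced by a map F and `q ^ n` by N, which frees the
  -- geometric argument from q-polynomials.
  FewPointsOnLines : ℕ → (Carrier → Carrier) → Set (c ⊔ ℓ)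
  FewPointsOnLines N F = ∀ (l : AffineLine) → ∃ λ k →
    HasCardinality (subsetSetoid pointSetoid (OnLine l ∩ Graph F)) k × k ℕ.^ 2 < N

-- Matrices preserving the graph of an additive map.

module Stabiliser {c ℓ} (K : Field c ℓ) {N : ℕ} (card : HasCardinality (Geometry.setoid K) N)
  (F : Field.Carrier K → Field.Carrier K)
  (F-cong : ∀ {x y} → Field._≈_ K x y → Field._≈_ K (F x) (F y))
  (F-+ : Frobenius.Additive (Field.commutativeRing K) F)
  (lowWeight : FewPointsOnLines K N F)
  where

  open CommutativeRing (Field.commutativeRing K) hiding (zero)
  open Field K using (1≉0; inverse)
  open Geometry K using (Point; AffineLine; OnLine; Graph; Matrix; matrixSetoid; _+ₘ_; _*ₘ_; _*ᵥ_; image)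
  open Setoid matrixSetoid using () renaming (_≈_ to _≋_)
  open Inverse card using (from)
  open FiniteSetoid setoid card using (_≟_; all?; from-injective; injective-endo⇒surjective)
  open FiniteField K card using (*-nonzero-cancelˡ; binary-form-represents-1)
  open IntegerCoefficientSolver (Field.commutativeRing K)
  open RingProperties ring using (x∙y⁻¹≈ε⇒x≈y; x≈y⇒x∙y⁻¹≈ε; x+x≈x⇒x≈0; -0#≈0#; +-inverseʳ-unique)
  open ≈-Reasoning setoid

  F-0 : F 0# ≈ 0#
  F-0 = x+x≈x⇒x≈0 _ (trans (sym (F-+ 0# 0#)) (F-cong (+-identityˡ 0#)))

  F-neg : ∀ x → F (- x) ≈ - F x
  F-neg x = +-inverseʳ-unique (F x) (F (- x)) (trans (sym (F-+ x (- x))) (trans (F-cong (-‿inverseʳ x)) F-0))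

  F-sub : ∀ x y → F (x - y) ≈ F x - F y
  F-sub x y = trans (F-+ x (- y)) (+-congˡ (F-neg y))

  row : Matrix → Fin 2 → Carrier → Carrier
  row A i y = A i 0F * y + A i 1F * F y

  Stable : Pred Matrix _
  Stable A = ∀ y → F (row A 0F y) ≈ row A 1F y

  Stabilises : Pred Matrix _
  Stabilises A = image A (Graph F) ⊆′ Graph F

  row≈*ᵥ : ∀ A i {P : Point} {y} → P 0F ≈ y → P 1F ≈ F y → (A *ᵥ P) i ≈ row A i y
  row≈*ᵥ A i P₀≈y P₁≈Fy = +-cong (*-congˡ P₀≈y) (trans (+-identityʳ _) (*-congˡ P₁≈Fy))

  stabilises⇒stable : ∀ A → Stabilises A → Stable A
  stabilises⇒stable A A-stabilises y =
    let Q = y ∷ F y ∷ []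
        z , eq = A-stabilises (A *ᵥ Q) (Q , (y , λ _ → refl) , λ _ → refl)
    in begin
      F (row A 0F y)       ≈⟨ F-cong (row≈*ᵥ A 0F {Q} refl refl) ⟨
      F ((A *ᵥ Q) 0F)      ≈⟨ F-cong (eq 0F) ⟩
      F z                  ≈⟨ eq 1F ⟨
      (A *ᵥ Q) 1F          ≈⟨ row≈*ᵥ A 1F {Q} refl refl ⟩
      row A 1F y           ∎

  stable⇒stabilises : ∀ A → Stable A → Stabilises A
  stable⇒stabilises A A-stable P (Q , (y , Q≋) , P≋) = P 0F , λ where
    0F → refl
    1F → begin
      P 1F             ≈⟨ P≋ 1F ⟩
      (A *ᵥ Q) 1F      ≈⟨ row≈*ᵥ A 1F {Q} (Q≋ 0F) (Q≋ 1F) ⟩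
      row A 1F y       ≈⟨ A-stable y ⟨
      F (row A 0F y)   ≈⟨ F-cong (row≈*ᵥ A 0F {Q} (Q≋ 0F) (Q≋ 1F)) ⟨
      F ((A *ᵥ Q) 0F)  ≈⟨ F-cong (P≋ 0F) ⟨
      F (P 0F)         ∎

  -- Closure under the ring operations.

  -ₘ_ : Matrix → Matrix
  (-ₘ A) i j = - A i j

  _-ₘ_ : Matrix → Matrix → Matrix
  (A -ₘ B) i j = A i j - B i j

  scalar : Carrier → Matrix
  scalar x = (x ∷ 0# ∷ []) ∷ (0# ∷ x ∷ []) ∷ []

  0ₘ 1ₘ : Matrix
  0ₘ _ _ = 0#
  1ₘ = scalar 1#

  -- Being dependent, it lets an entrywise proof be laid out like the matrix it concerns.
  ⟨_,_⟩ : ∀ {p} {P : Fin 2 → Set p} → P 0F → P 1F → ∀ i → P i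
  ⟨ x , y ⟩ 0F = x
  ⟨ x , y ⟩ 1F = y

  row-cong : ∀ {A B} → A ≋ B → ∀ i {y z} → y ≈ z → row A i y ≈ row B i z
  row-cong A≋B i y≈z = +-cong (*-cong (A≋B i 0F) y≈z) (*-cong (A≋B i 1F) (F-cong y≈z))

  row-+ : ∀ A B i y → row (A +ₘ B) i y ≈ row A i y + row B i y
  row-+ A B i y = solve 6 (λ a b a′ b′ y z → (a :+ a′) :* y :+ (b :+ b′) :* z := a :* y :+ b :* z :+ (a′ :* y :+ b′ :* z)) refl
    (A i 0F) (A i 1F) (B i 0F) (B i 1F) y (F y)

  row-neg : ∀ A i y → row (-ₘ A) i y ≈ - row A i y
  row-neg A i y = solve 4 (λ a b y z → :- a :* y :+ :- b :* z := :- (a :* y :+ b :* z)) refl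
    (A i 0F) (A i 1F) y (F y)

  row-sub : ∀ A i y z → row A i (y - z) ≈ row A i y - row A i z
  row-sub A i y z = trans (+-congˡ (*-congˡ (F-sub y z)))
    (solve 6 (λ a b y z u v → a :* (y :- z) :+ b :* (u :- v) := a :* y :+ b :* u :- (a :* z :+ b :* v)) refl
      (A i 0F) (A i 1F) y z (F y) (F z))

  -- Because B is stable, B (y, F y) is the graph point over `row B 0F y`, and A then acts on that
  -- point.
  row-* : ∀ A {B} → Stable B → ∀ i y → row (A *ₘ B) i y ≈ row A i (row B 0F y)
  row-* A {B} B-stable i y = trans
    -- The trailing `:0` mirrors the empty sum that ends a `sum` over two indices.
    (solve 8 (λ a a′ b b′ d d′ y z →
        (a :* b :+ (a′ :* d :+ :0)) :* y :+ (a :* b′ :+ (a′ :* d′ :+ :0)) :* z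
        := a :* (b :* y :+ b′ :* z) :+ a′ :* (d :* y :+ d′ :* z)) refl
      (A i 0F) (A i 1F) (B 0F 0F) (B 0F 1F) (B 1F 0F) (B 1F 1F) y (F y))
    (+-congˡ (*-congˡ (sym (B-stable y))))

  stable-resp : ∀ {A B} → A ≋ B → Stable A → Stable B
  stable-resp {A} {B} A≋B A-stable y = begin
    F (row B 0F y)   ≈⟨ F-cong (row-cong {A} {B} A≋B 0F refl) ⟨
    F (row A 0F y)   ≈⟨ A-stable y ⟩
    row A 1F y       ≈⟨ row-cong {A} {B} A≋B 1F refl ⟩
    row B 1F y       ∎

  stable-+ : ∀ {A B} → Stable A → Stable B → Stable (A +ₘ B)
  stable-+ {A} {B} A-stable B-stable y = begin
    F (row (A +ₘ B) 0F y)              ≈⟨ F-cong (row-+ A B 0F y) ⟩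
    F (row A 0F y + row B 0F y)        ≈⟨ F-+ _ _ ⟩
    F (row A 0F y) + F (row B 0F y)    ≈⟨ +-cong (A-stable y) (B-stable y) ⟩
    row A 1F y + row B 1F y            ≈⟨ row-+ A B 1F y ⟨
    row (A +ₘ B) 1F y                  ∎

  stable-neg : ∀ {A} → Stable A → Stable (-ₘ A)
  stable-neg {A} A-stable y = begin
    F (row (-ₘ A) 0F y)   ≈⟨ F-cong (row-neg A 0F y) ⟩
    F (- row A 0F y)      ≈⟨ F-neg _ ⟩
    - F (row A 0F y)      ≈⟨ -‿cong (A-stable y) ⟩
    - row A 1F y          ≈⟨ row-neg A 1F y ⟨
    row (-ₘ A) 1F y       ∎

  stable-sub : ∀ {A B} → Stable A → Stable B → Stable (A -ₘ B)
  stable-sub {A} {B} A-stable B-stable = stable-+ {A} { -ₘ B} A-stable (stable-neg {B} B-stable)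

  stable-* : ∀ {A B} → Stable A → Stable B → Stable (A *ₘ B)
  stable-* {A} {B} A-stable B-stable y = begin
    F (row (A *ₘ B) 0F y)       ≈⟨ F-cong (row-* A {B} B-stable 0F y) ⟩
    F (row A 0F (row B 0F y))   ≈⟨ A-stable (row B 0F y) ⟩
    row A 1F (row B 0F y)       ≈⟨ row-* A {B} B-stable 1F y ⟨
    row (A *ₘ B) 1F y           ∎

  stable-0 : Stable 0ₘ
  stable-0 y = begin
    F (row 0ₘ 0F y)  ≈⟨ F-cong (row-0 0F) ⟩
    F 0#             ≈⟨ F-0 ⟩
    0#               ≈⟨ row-0 1F ⟨
    row 0ₘ 1F y      ∎
    where
    row-0 : ∀ i → row 0ₘ i y ≈ 0#
    row-0 i = solve 2 (λ y z → :0 :* y :+ :0 :* z := :0) refl y (F y)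

  stable-1 : Stable 1ₘ
  stable-1 y = begin
    F (row 1ₘ 0F y)  ≈⟨ F-cong (solve 2 (λ y z → :1 :* y :+ :0 :* z := y) refl y (F y)) ⟩
    F y              ≈⟨ solve 2 (λ y z → :0 :* y :+ :1 :* z := z) refl y (F y) ⟨
    row 1ₘ 1F y      ∎

  -- Singular elements.

  det trace : Matrix → Carrier
  det A = A 0F 0F * A 1F 1F - A 0F 1F * A 1F 0F
  trace A = A 0F 0F + A 1F 1F

  IsZero : Pred Matrix _
  IsZero A = ∀ i j → A i j ≈ 0#

  isZero? : Unary.Decidable IsZero
  isZero? A = Fin.all? λ i → Fin.all? λ j → A i j ≟ 0#

  nonzero-entry : ∀ A → ¬ IsZero A → ∃₂ λ i j → ¬ A i j ≈ 0#
  nonzero-entry A A≉0 =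
    let i , Aᵢ≉0 = Fin.¬∀⟶∃¬ 2 _ (λ i → Fin.all? λ j → A i j ≟ 0#) A≉0
    in i , Fin.¬∀⟶∃¬ 2 _ (λ j → A i j ≟ 0#) Aᵢ≉0

  -- A nonzero linear form has its kernel spanned by (-b, a). The factor t is z / a or -y / b,
  -- according to which coefficient is found nonzero.
  kernel-direction : ∀ {a b} → ¬ (a ≈ 0# × b ≈ 0#) → ∀ {y z} → a * y + b * z ≈ 0# → ∃ λ t → y ≈ t * - b × z ≈ t * a
  kernel-direction {a} {b} ab≉0 {y} {z} eq with a ≟ 0# | b ≟ 0#
  ... | yes a≈0 | yes b≈0 = contradiction (a≈0 , b≈0) ab≉0
  ... | no a≉0  | _ = let a⁻¹ , aa⁻¹≈1 = inverse a a≉0 in z * a⁻¹ ,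
    (begin
      y
        -- The identity adds multiples of two expressions known to vanish, `a * y + b * z` and
        -- `a * a⁻¹ - 1#`.
        ≈⟨ solve 5 (λ a b i y z → y := (z :* i) :* (:- b) :+ i :* (a :* y :+ b :* z) :- y :* (a :* i :- :1)) refl
              a b a⁻¹ y z ⟩
      z * a⁻¹ * - b + a⁻¹ * (a * y + b * z) - y * (a * a⁻¹ - 1#) ≈⟨ +-cong (+-congˡ (*-congˡ eq)) (-‿cong (*-congˡ (x≈y⇒x∙y⁻¹≈ε aa⁻¹≈1))) ⟩
      z * a⁻¹ * - b + a⁻¹ * 0# - y * 0#                        ≈⟨ solve 3 (λ i y x → x :+ i :* :0 :- y :* :0 := x) refl
            a⁻¹ y _ ⟩
      z * a⁻¹ * - b                                            ∎) ,
    (begin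
      z              ≈⟨ *-identityʳ z ⟨
      z * 1#         ≈⟨ *-congˡ aa⁻¹≈1 ⟨
      z * (a * a⁻¹)  ≈⟨ solve 3 (λ z a i → z :* (a :* i) := z :* i :* a) refl z a a⁻¹ ⟩
      z * a⁻¹ * a    ∎)
  ... | yes _ | no b≉0 = let b⁻¹ , bb⁻¹≈1 = inverse b b≉0 in - (y * b⁻¹) ,
    (begin
      y                  ≈⟨ *-identityʳ y ⟨
      y * 1#             ≈⟨ *-congˡ bb⁻¹≈1 ⟨
      y * (b * b⁻¹)      ≈⟨ solve 3 (λ y b i → y :* (b :* i) := :- (y :* i) :* :- b) refl y b b⁻¹ ⟩
      - (y * b⁻¹) * - b  ∎) ,
    (begin
      z
        ≈⟨ solve 5 (λ a b i y z → z := :- (y :* i) :* a :+ i :* (a :* y :+ b :* z) :- z :* (b :* i :- :1)) refl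
              a b b⁻¹ y z ⟩
      - (y * b⁻¹) * a + b⁻¹ * (a * y + b * z) - z * (b * b⁻¹ - 1#)
        ≈⟨ +-cong (+-congˡ (*-congˡ eq)) (-‿cong (*-congˡ (x≈y⇒x∙y⁻¹≈ε bb⁻¹≈1))) ⟩
      - (y * b⁻¹) * a + b⁻¹ * 0# - z * 0#                      ≈⟨ solve 3 (λ i y x → x :+ i :* :0 :- y :* :0 := x) refl
            b⁻¹ z _ ⟩
      - (y * b⁻¹) * a                                          ∎)

  -- Only an upper bound is kept: the roots inject into `Fin bound`. An index is computed from a
  -- proof of the root equation, so injectivity has to allow two different proofs.
  record FewRoots (a b : Carrier) : Set (c ⊔ ℓ) where
    field
      bound           : ℕ
      bound²<N        : bound ℕ.^ 2 < N
      index           : ∀ y → a * y + b * F y ≈ 0# → Fin bound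
      index-injective : ∀ {y z} e e′ → index y e ≡ index z e′ → y ≈ z

  -- The roots of a y + b f(y) are the points of the graph on the line through 0 with direction (-b, a).
  few-roots : ∀ {a b} → ¬ (a ≈ 0# × b ≈ 0#) → FewRoots a b
  few-roots {a} {b} ab≉0 = record
    { bound           = k
    ; bound²<N        = k²<N
    ; index           = λ y e → Inverse.to l∩G (graph-point y e)
    ; index-injective = λ e e′ eq → FiniteSetoid.to-injective _ l∩G {graph-point _ e} {graph-point _ e′} eq 0F
    }
    where
    l : AffineLine
    l = record
      { base        = replicate 2 0#
      ; direction   = - b ∷ a ∷ []
      ; direction≉0 = λ d≋0 → ab≉0 (d≋0 1F , (begin
          b        ≈⟨ solve 1 (λ b → b := :- :- b) refl b ⟩
          - - b    ≈⟨ -‿cong (d≋0 0F) ⟩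
          - 0#     ≈⟨ -0#≈0# ⟩
          0#       ∎))
      }

    k    = proj₁ (lowWeight l)
    l∩G  = proj₁ (proj₂ (lowWeight l))
    k²<N = proj₂ (proj₂ (lowWeight l))

    graph-point : ∀ y → a * y + b * F y ≈ 0# → Σ Point (OnLine l ∩ Graph F)
    graph-point y e =
      let t , y≈ , Fy≈ = kernel-direction ab≉0 e
      in (y ∷ F y ∷ []) , (t , ⟨ trans y≈ (sym (+-identityˡ _)) , trans Fy≈ (sym (+-identityˡ _)) ⟩) , (y , λ _ → refl)

  -- A singular A ≠ 0 maps the N points of the graph into a line, with fibres contained in translates of a
  -- second line; each of the two lines meets the graph in fewer than √N points.
  singular-stable⇒zero : ∀ A → Stable A → det A ≈ 0# → IsZero A
  singular-stable⇒zero A A-stable det≈0 = decidable-stable (isZero? A) λ A≉0 →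
    let i , j , Aᵢⱼ≉0 = nonzero-entry A A≉0
    in absurd i j Aᵢⱼ≉0
    where
    module _ (i j : Fin 2) (Aᵢⱼ≉0 : ¬ A i j ≈ 0#) where
      row≉0 : ∀ j → ¬ A i j ≈ 0# → ¬ (A i 0F ≈ 0# × A i 1F ≈ 0#)
      row≉0 0F Aᵢⱼ≉0 = Aᵢⱼ≉0 ∘ proj₁
      row≉0 1F Aᵢⱼ≉0 = Aᵢⱼ≉0 ∘ proj₂

      column≉0 : ∀ i → ¬ A i j ≈ 0# → ¬ (A 1F j ≈ 0# × - A 0F j ≈ 0#)
      column≉0 1F Aᵢⱼ≉0 (eq , _) = Aᵢⱼ≉0 eq
      column≉0 0F Aᵢⱼ≉0 (_ , eq) = Aᵢⱼ≉0 (begin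
        A 0F j      ≈⟨ solve 1 (λ b → b := :- :- b) refl (A 0F j) ⟩
        - - A 0F j  ≈⟨ -‿cong eq ⟩
        - 0#        ≈⟨ -0#≈0# ⟩
        0#          ∎)

      -- The kernel of A lies in the zero set of its nonzero row i. Its image is spanned by the
      -- nonzero column j, and so is annihilated by the form with coefficients `A 1F j` and
      -- `- A 0F j`.
      module Kernel = FewRoots (few-roots (row≉0 j Aᵢⱼ≉0))
      module Image  = FewRoots (few-roots (column≉0 i Aᵢⱼ≉0))

      -- Eliminating coordinate j from the two rows leaves a multiple of the determinant.
      det-relation : ∀ j y z → A 1F j * (A 0F 0F * y + A 0F 1F * z) + - A 0F j * (A 1F 0F * y + A 1F 1F * z) ≈ 0#
      det-relation 0F y z = begin
        _
          ≈⟨ solve 6 (λ a b c d y z → c :* (a :* y :+ b :* z) :+ :- a :* (c :* y :+ d :* z) := :- z :* (a :* d :- b :* c)) refl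
                (A 0F 0F) (A 0F 1F) (A 1F 0F) (A 1F 1F) y z ⟩
        - z * det A     ≈⟨ *-congˡ det≈0 ⟩
        - z * 0#        ≈⟨ zeroʳ _ ⟩
        0#              ∎
      det-relation 1F y z = begin
        _
          ≈⟨ solve 6 (λ a b c d y z → d :* (a :* y :+ b :* z) :+ :- b :* (c :* y :+ d :* z) := y :* (a :* d :- b :* c)) refl
                (A 0F 0F) (A 0F 1F) (A 1F 0F) (A 1F 1F) y z ⟩
        y * det A       ≈⟨ *-congˡ det≈0 ⟩
        y * 0#          ≈⟨ zeroʳ _ ⟩
        0#              ∎

      image-root : ∀ y → A 1F j * row A 0F y + - A 0F j * F (row A 0F y) ≈ 0#
      image-root y = trans (+-congˡ (*-congˡ (A-stable y))) (det-relation j y (F y))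

      α : Fin N → Fin Image.bound
      α s = Image.index (row A 0F (from s)) (image-root (from s))

      -- α sees only the first coordinate of the image point, but i may be 1. The image point lies
      -- on the graph, so its first coordinate fixes the second.
      row-0-determines : ∀ i {y z} → row A 0F y ≈ row A 0F z → row A i y ≈ row A i z
      row-0-determines 0F eq = eq
      row-0-determines 1F {y} {z} eq = trans (sym (A-stable y)) (trans (F-cong eq) (A-stable z))

      kernel-root : ∀ s t → α s ≡ α t → row A i (from s - from t) ≈ 0#
      kernel-root s t eq = trans (row-sub A i _ _) (x≈y⇒x∙y⁻¹≈ε (row-0-determines i (Image.index-injective _ _ eq)))

      absurd : ⊥
      absurd = ℕ.<⇒≱ (squares<⇒product< Image.bound Kernel.bound Image.bound²<N Kernel.bound²<N)
        (fibre-bound α (λ s t e → Kernel.index (from s - from t) (kernel-root s t e))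
          λ {s} {s′} {t} e e′ eq → from-injective (begin
            from s                      ≈⟨ solve 2 (λ x y → x := x :- y :+ y) refl (from s) (from t) ⟩
            from s - from t + from t    ≈⟨ +-congʳ (Kernel.index-injective (kernel-root s t e) (kernel-root s′ t e′) eq) ⟩
            from s′ - from t + from t   ≈⟨ solve 2 (λ x y → x := x :- y :+ y) refl (from s′) (from t) ⟨
            from s′                     ∎))

  -- Traceless matrices and their quadratic form.

  quadratic : Matrix → Carrier
  quadratic A = A 0F 0F * A 0F 0F + A 0F 1F * A 1F 0F

  -- The polarisation of `quadratic`; on traceless A and B it equals tr(A B).
  polar : Matrix → Matrix → Carrier
  polar A B = A 0F 0F * B 0F 0F + A 0F 0F * B 0F 0F + A 0F 1F * B 1F 0F + A 1F 0F * B 0F 1F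

  commutator : Matrix → Matrix → Matrix
  commutator A B = (A *ₘ B) -ₘ (B *ₘ A)

  combination : Carrier → Matrix → Carrier → Matrix → Matrix
  combination v A w B i j = v * A i j + w * B i j

  -- Extends the solver to identities modulo a relation z = 0, most often the vanishing of a trace;
  -- y is the explicit cofactor.
  drop-multiple : ∀ {x w} y {z} → z ≈ 0# → x ≈ w + y * z → x ≈ w
  drop-multiple {x} {w} y {z} z≈0 eq = begin
    x            ≈⟨ eq ⟩
    w + y * z    ≈⟨ +-congˡ (trans (*-congˡ z≈0) (zeroʳ y)) ⟩
    w + 0#       ≈⟨ +-identityʳ w ⟩
    w            ∎

  -- Cayley-Hamilton, C² = tr(C) C - det C, with vanishing trace.
  traceless-square : ∀ C → trace C ≈ 0# → C *ₘ C ≋ scalar (quadratic C)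
  traceless-square C tr≈0 = ⟨
    ⟨ solve 4 (λ a b c d → a :* a :+ (b :* c :+ :0) := a :* a :+ b :* c) refl c₀₀ c₀₁ c₁₀ c₁₁ ,
      drop-multiple c₀₁ tr≈0 (solve 4 (λ a b c d → a :* b :+ (b :* d :+ :0) := :0 :+ b :* (a :+ d)) refl
            c₀₀ c₀₁ c₁₀ c₁₁) ⟩ ,
    ⟨ drop-multiple c₁₀ tr≈0 (solve 4 (λ a b c d → c :* a :+ (d :* c :+ :0) := :0 :+ c :* (a :+ d)) refl
          c₀₀ c₀₁ c₁₀ c₁₁) ,
      drop-multiple (c₁₁ - c₀₀) tr≈0 (solve 4 (λ a b c d → c :* b :+ (d :* d :+ :0) := a :* a :+ b :* c :+ (d :- a) :* (a :+ d)) refl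
            c₀₀ c₀₁ c₁₀ c₁₁) ⟩ ⟩
    where
    c₀₀ = C 0F 0F
    c₀₁ = C 0F 1F
    c₁₀ = C 1F 0F
    c₁₁ = C 1F 1F

  -- Here `det C` is `- quadratic C`, so a zero value would make C a singular element of S, hence
  -- zero.
  quadratic-nonzero : ∀ C → Stable C → trace C ≈ 0# → ¬ IsZero C → ¬ quadratic C ≈ 0#
  quadratic-nonzero C C-stable tr≈0 C≉0 Q≈0 = C≉0 (singular-stable⇒zero C C-stable (drop-multiple (C 0F 0F) tr≈0 (begin
    det C
      ≈⟨ solve 4 (λ a b c d → a :* d :- b :* c := :- (a :* a :+ b :* c) :+ a :* (a :+ d)) refl
            (C 0F 0F) (C 0F 1F) (C 1F 0F) (C 1F 1F) ⟩
    - quadratic C + C 0F 0F * trace C  ≈⟨ +-congʳ (trans (-‿cong Q≈0) -0#≈0#) ⟩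
    0# + C 0F 0F * trace C             ∎)))

  -- det (Y - 1) = 1 - tr Y + det Y.
  traceless-involution≈1 : ∀ Y → Stable Y → trace Y ≈ 0# → quadratic Y ≈ 1# → IsZero (Y -ₘ 1ₘ)
  traceless-involution≈1 Y Y-stable tr≈0 Q≈1 =
    singular-stable⇒zero (Y -ₘ 1ₘ) (stable-sub {Y} {1ₘ} Y-stable stable-1) (drop-multiple (Y 0F 0F - 1#) tr≈0 (begin
      det (Y -ₘ 1ₘ)
        ≈⟨ solve 4 (λ a b c d → (a :- :1) :* (d :- :1) :- (b :- :0) :* (c :- :0)
                      := (:1 :- (a :* a :+ b :* c)) :+ (a :- :1) :* (a :+ d)) refl (Y 0F 0F) (Y 0F 1F) (Y 1F 0F) (Y 1F 1F) ⟩
      (1# - quadratic Y) + (Y 0F 0F - 1#) * trace Y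
        ≈⟨ +-congʳ (x≈y⇒x∙y⁻¹≈ε (sym Q≈1)) ⟩
      0# + (Y 0F 0F - 1#) * trace Y ∎))

  -- The scalars in the stabiliser.

  -- The set k of the counting argument. It is decidable, since its defining equation can be tested
  -- at every element of the finite field.
  StableScalar : Pred Carrier _
  StableScalar x = Stable (scalar x)

  scalar-cong : ∀ {x y} → x ≈ y → scalar x ≋ scalar y
  scalar-cong x≈y = ⟨ ⟨ x≈y , refl ⟩ , ⟨ refl , x≈y ⟩ ⟩

  stableScalar? : Unary.Decidable StableScalar
  stableScalar? x = all?
    (λ y≈z eq → trans (F-cong (sym (row-cong {scalar x} {scalar x} (λ _ _ → refl) 0F y≈z))) (trans eq (row-cong {scalar x} {scalar x} (λ _ _ → refl) 1F y≈z)))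
    (λ y → F (row (scalar x) 0F y) ≟ row (scalar x) 1F y)

  stableScalar-0 : StableScalar 0#
  stableScalar-0 = stable-resp {0ₘ} {scalar 0#} ⟨ ⟨ refl , refl ⟩ , ⟨ refl , refl ⟩ ⟩ stable-0

  stableScalar-* : ∀ {x y} → StableScalar x → StableScalar y → StableScalar (x * y)
  stableScalar-* {x} {y} x-stable y-stable = stable-resp {scalar x *ₘ scalar y} {scalar (x * y)} ⟨
    ⟨ solve 2 (λ x y → x :* y :+ (:0 :* :0 :+ :0) := x :* y) refl
          x y , solve 2 (λ x y → x :* :0 :+ (:0 :* y :+ :0) := :0) refl x y ⟩ ,
    ⟨ solve 2 (λ x y → :0 :* y :+ (x :* :0 :+ :0) := :0) refl
          x y , solve 2 (λ x y → :0 :* :0 :+ (x :* y :+ :0) := x :* y) refl x y ⟩ ⟩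
    (stable-* {scalar x} {scalar y} x-stable y-stable)

  stableScalar-1- : ∀ {x} → StableScalar x → StableScalar (1# - x)
  stableScalar-1- {x} x-stable = stable-resp {1ₘ -ₘ scalar x} {scalar (1# - x)}
    ⟨ ⟨ refl , -‿inverseʳ 0# ⟩ , ⟨ -‿inverseʳ 0# , refl ⟩ ⟩
    (stable-sub {1ₘ} {scalar x} stable-1 x-stable)

  -- Multiplication by v is the matrix product with `scalar v`, so it preserves S when v lies in k.
  stable-combination : ∀ {v A w B} → StableScalar v → Stable A → StableScalar w → Stable B → Stable (combination v A w B)
  stable-combination {v} {A} {w} {B} v-stable A-stable w-stable B-stable =
    stable-resp {(scalar v *ₘ A) +ₘ (scalar w *ₘ B)} {combination v A w B}
      ⟨ (λ j → solve 6 (λ v w a a′ b b′ → v :* a :+ (:0 :* a′ :+ :0) :+ (w :* b :+ (:0 :* b′ :+ :0)) := v :* a :+ w :* b) refl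
                 v w (A 0F j) (A 1F j) (B 0F j) (B 1F j)) ,
        (λ j → solve 6 (λ v w a a′ b b′ → :0 :* a :+ (v :* a′ :+ :0) :+ (:0 :* b :+ (w :* b′ :+ :0)) := v :* a′ :+ w :* b′) refl
                 v w (A 0F j) (A 1F j) (B 0F j) (B 1F j)) ⟩
      (stable-+ {scalar v *ₘ A} {scalar w *ₘ B} (stable-* {scalar v} {A} v-stable A-stable) (stable-* {scalar w} {B} w-stable B-stable))

  stable-commutator : ∀ {A B} → Stable A → Stable B → Stable (commutator A B)
  stable-commutator {A} {B} A-stable B-stable =
    stable-sub {A *ₘ B} {B *ₘ A} (stable-* {A} {B} A-stable B-stable) (stable-* {B} {A} B-stable A-stable)

  -- If C and X are orthogonal, then (v C + w X)² = v² C² + w² X², and v, w can be chosen to make this 1.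
  orthogonal-combination≈1 : ∀ {C X} → Stable C → Stable X → trace C ≈ 0# → trace X ≈ 0# →
    ¬ IsZero C → ¬ IsZero X → polar C X ≈ 0# → ¬ (∀ v w → ¬ IsZero (combination v C w X -ₘ 1ₘ))
  orthogonal-combination≈1 {C} {X} C-stable X-stable trC≈0 trX≈0 C≉0 X≉0 polar≈0 ≉1 =
    binary-form-represents-1 (λ {x} {y} x≈y → stable-resp {scalar x} {scalar y} (scalar-cong x≈y)) stableScalar?
      stableScalar-0 stableScalar-* stableScalar-1-
      (square-scalar C C-stable trC≈0) (square-scalar X X-stable trX≈0)
      (quadratic-nonzero C C-stable trC≈0 C≉0) (quadratic-nonzero X X-stable trX≈0 X≉0)
      λ v w v-stable w-stable represents-1 → ≉1 v w (traceless-involution≈1 (combination v C w X)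
        (stable-combination {v} {C} {w} {X} v-stable C-stable w-stable X-stable)
        (trace≈0 v w)
        (trans (quadratic-combination v w) represents-1))
    where
    square-scalar : ∀ A → Stable A → trace A ≈ 0# → StableScalar (quadratic A)
    square-scalar A A-stable tr≈0 =
      stable-resp {A *ₘ A} {scalar (quadratic A)} (traceless-square A tr≈0) (stable-* {A} {A} A-stable A-stable)

    trace≈0 : ∀ v w → trace (combination v C w X) ≈ 0#
    trace≈0 v w = drop-multiple v trC≈0 (drop-multiple w trX≈0
      (solve 6 (λ v w a d a′ d′ → v :* a :+ w :* a′ :+ (v :* d :+ w :* d′) := :0 :+ v :* (a :+ d) :+ w :* (a′ :+ d′)) refl
        v w (C 0F 0F) (C 1F 1F) (X 0F 0F) (X 1F 1F)))

    quadratic-combination : ∀ v w → quadratic (combination v C w X) ≈ quadratic C * (v * v) + quadratic X * (w * w)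
    quadratic-combination v w = drop-multiple (v * w) polar≈0
      (solve 8 (λ v w a b c a′ b′ c′ →
          (v :* a :+ w :* a′) :* (v :* a :+ w :* a′) :+ (v :* b :+ w :* b′) :* (v :* c :+ w :* c′)
          := (a :* a :+ b :* c) :* (v :* v) :+ (a′ :* a′ :+ b′ :* c′) :* (w :* w)
             :+ (v :* w) :* (a :* a′ :+ a :* a′ :+ b :* c′ :+ c :* b′)) refl
        v w (C 0F 0F) (C 0F 1F) (C 1F 0F) (X 0F 0F) (X 0F 1F) (X 1F 0F))

  -- Commutativity.

  infixl 8 _:*ₘ_
  -- Symbolic copies of the matrix operations, term for term, so that the solver can be given
  -- identities between matrices of variables.
  _:*ₘ_ :commutator : ∀ {m} (A B : Fin 2 → Fin 2 → Polynomial m) → Fin 2 → Fin 2 → Polynomial m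
  (A :*ₘ B) i j = A i 0F :* B 0F j :+ (A i 1F :* B 1F j :+ :0)
  :commutator A B i j = (A :*ₘ B) i j :- (B :*ₘ A) i j

  :matrix : ∀ {m} (a b c d : Polynomial m) → Fin 2 → Fin 2 → Polynomial m
  :matrix a b c d = ⟨ ⟨ a , b ⟩ , ⟨ c , d ⟩ ⟩

  trace-commutator : ∀ A B → trace (commutator A B) ≈ 0#
  trace-commutator A B = solve 8 (λ a b c d a′ b′ c′ d′ →
      let C = :commutator (:matrix a b c d) (:matrix a′ b′ c′ d′) in C 0F 0F :+ C 1F 1F := :0) refl
    (A 0F 0F) (A 0F 1F) (A 1F 0F) (A 1F 1F) (B 0F 0F) (B 0F 1F) (B 1F 0F) (B 1F 1F)

  -- On traceless matrices the polar form is tr(C X), and tr(C (C A - A C)) = 0 because the trace is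
  -- cyclic.
  polar-commutator : ∀ {C} A → trace C ≈ 0# → polar C (commutator C A) ≈ 0#
  polar-commutator {C} A tr≈0 = drop-multiple (- commutator C A 1F 1F) tr≈0 (solve 8 (λ a b c d a′ b′ c′ d′ →
      let C = :matrix a b c d
          X = :commutator C (:matrix a′ b′ c′ d′)
      in a :* X 0F 0F :+ a :* X 0F 0F :+ b :* X 1F 0F :+ c :* X 0F 1F := :0 :+ :- X 1F 1F :* (a :+ d)) refl
    (C 0F 0F) (C 0F 1F) (C 1F 0F) (C 1F 1F) (A 0F 0F) (A 0F 1F) (A 1F 0F) (A 1F 1F))

  -- The right side is tr(X B) written out. As C is traceless, 2 Q(C) = tr(C²) = tr(C [A, B]) =
  -- tr([C, A] B).
  2*quadratic-commutator : ∀ A B → let C = commutator A B; X = commutator C A in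
    (1# + 1#) * quadratic C ≈ X 0F 0F * B 0F 0F + X 0F 1F * B 1F 0F + (X 1F 0F * B 0F 1F + X 1F 1F * B 1F 1F)
  2*quadratic-commutator A B = solve 8 (λ a b c d a′ b′ c′ d′ →
      let A = :matrix a b c d
          C = :commutator A (:matrix a′ b′ c′ d′)
          X = :commutator C A
      in (:1 :+ :1) :* (C 0F 0F :* C 0F 0F :+ C 0F 1F :* C 1F 0F)
         := X 0F 0F :* a′ :+ X 0F 1F :* c′ :+ (X 1F 0F :* b′ :+ X 1F 1F :* d′)) refl
    (A 0F 0F) (A 0F 1F) (A 1F 0F) (A 1F 1F) (B 0F 0F) (B 0F 1F) (B 1F 0F) (B 1F 1F)

  commutes-odd : ¬ 1# + 1# ≈ 0# → ∀ {A B} → Stable A → Stable B → IsZero (commutator A B)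
  commutes-odd 2≉0 {A} {B} A-stable B-stable = decidable-stable (isZero? C) λ C≉0 → absurd C≉0 (isZero? X)
    where
    C = commutator A B
    X = commutator C A
    C-stable = stable-commutator {A} {B} A-stable B-stable
    X-stable = stable-commutator {C} {A} C-stable A-stable
    trC≈0    = trace-commutator A B
    trX≈0    = trace-commutator C A

    absurd : ¬ IsZero C → ¬ Dec (IsZero X)
    absurd C≉0 (yes X≈0) = quadratic-nonzero C C-stable trC≈0 C≉0 (*-nonzero-cancelˡ 2≉0 (begin
      (1# + 1#) * quadratic C
        ≈⟨ 2*quadratic-commutator A B ⟩
      X 0F 0F * B 0F 0F + X 0F 1F * B 1F 0F + (X 1F 0F * B 0F 1F + X 1F 1F * B 1F 1F)
        ≈⟨ +-cong (+-cong (*-congʳ (X≈0 0F 0F)) (*-congʳ (X≈0 0F 1F))) (+-cong (*-congʳ (X≈0 1F 0F)) (*-congʳ (X≈0 1F 1F))) ⟩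
      0# * B 0F 0F + 0# * B 1F 0F + (0# * B 0F 1F + 0# * B 1F 1F)
        ≈⟨ solve 4 (λ a b c d → :0 :* a :+ :0 :* c :+ (:0 :* b :+ :0 :* d) := :0) refl
              (B 0F 0F) (B 0F 1F) (B 1F 0F) (B 1F 1F) ⟩
      0# ∎))
    absurd C≉0 (no X≉0) = orthogonal-combination≈1 {C} {X} C-stable X-stable trC≈0 trX≈0 C≉0 X≉0 (polar-commutator {C} A trC≈0)
      -- The combination has trace 0, being built from C and X, while the identity has trace 2.
      λ v w Y≈1 → 2≉0 (begin
        1# + 1#
          ≈⟨ solve 6 (λ v w a d a′ d′ → :1 :+ :1 := :0 :+ v :* (a :+ d) :+ w :* (a′ :+ d′)
                        :- (v :* a :+ w :* a′ :- :1) :- (v :* d :+ w :* d′ :- :1)) refl v w (C 0F 0F) (C 1F 1F) (X 0F 0F) (X 1F 1F) ⟩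
        0# + v * trace C + w * trace X - (combination v C w X -ₘ 1ₘ) 0F 0F - (combination v C w X -ₘ 1ₘ) 1F 1F
          ≈⟨ +-cong (+-cong (+-cong (+-congˡ (*-congˡ trC≈0)) (*-congˡ trX≈0)) (-‿cong (Y≈1 0F 0F))) (-‿cong (Y≈1 1F 1F)) ⟩
        0# + v * 0# + w * 0# - 0# - 0#
          ≈⟨ solve 2 (λ v w → :0 :+ v :* :0 :+ w :* :0 :- :0 :- :0 := :0) refl v w ⟩
        0# ∎)

  -- In characteristic 2 a traceless C is orthogonal to itself, so if C is nonzero some (v + w) C
  -- cannot be kept from being 1. A nonzero entry off the diagonal, where `1ₘ` vanishes, then gives
  -- v + w = 0, and the diagonal reads 0 = 1.
  off-diagonal≈0 : 1# + 1# ≈ 0# → ∀ {C} → Stable C → trace C ≈ 0# → ∀ i j → 1ₘ i j ≈ 0# → C i j ≈ 0#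
  off-diagonal≈0 2≈0 {C} C-stable tr≈0 i j 1ᵢⱼ≈0 = decidable-stable (C i j ≟ 0#) λ Cᵢⱼ≉0 →
    let C≉0 = λ C≈0 → Cᵢⱼ≉0 (C≈0 i j) in
    orthogonal-combination≈1 {C} {C} C-stable C-stable tr≈0 tr≈0 C≉0 C≉0
      (trans
        (solve 3 (λ a b c → a :* a :+ a :* a :+ b :* c :+ c :* b := (:1 :+ :1) :* (a :* a :+ b :* c)) refl
              (C 0F 0F) (C 0F 1F) (C 1F 0F))
        (trans (*-congʳ 2≈0) (zeroˡ _)))
      λ v w Y≈1 →
        let v+w≈0 : v + w ≈ 0#
            v+w≈0 = *-nonzero-cancelˡ Cᵢⱼ≉0 (begin
              C i j * (v + w)            ≈⟨ solve 4 (λ v w x y → x :* (v :+ w) := v :* x :+ w :* x :- y :+ y) refl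
                    v w (C i j) (1ₘ i j) ⟩
              v * C i j + w * C i j - 1ₘ i j + 1ₘ i j  ≈⟨ +-cong (Y≈1 i j) 1ᵢⱼ≈0 ⟩
              0# + 0#                    ≈⟨ +-identityˡ 0# ⟩
              0#                         ∎)
        in 1≉0 (begin
          1#
            ≈⟨ solve 3 (λ v w x → :1 := x :* (v :+ w) :- (v :* x :+ w :* x :- :1)) refl v w (C 0F 0F) ⟩
          C 0F 0F * (v + w) - (v * C 0F 0F + w * C 0F 0F - 1#) ≈⟨ +-cong (*-congˡ v+w≈0) (-‿cong (Y≈1 0F 0F)) ⟩
          C 0F 0F * 0# - 0#                                    ≈⟨ solve 1 (λ x → x :* :0 :- :0 := :0) refl (C 0F 0F) ⟩
          0#                                                   ∎)

  -- Both C and E = A C are commutators, so their off-diagonal entries vanish; comparing them forces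
  -- A to be diagonal unless `C 0F 0F` is 0.
  commutes-even : 1# + 1# ≈ 0# → ∀ {A B} → Stable A → Stable B → IsZero (commutator A B)
  commutes-even 2≈0 {A} {B} A-stable B-stable = ⟨ ⟨ C₀₀≈0 , C₀₁≈0 ⟩ , ⟨ C₁₀≈0 , C₁₁≈0 ⟩ ⟩
    where
    C = commutator A B

    -- [A, A B] = A [A, B]
    E = commutator A (A *ₘ B)

    C-stable = stable-commutator {A} {B} A-stable B-stable
    E-stable = stable-commutator {A} {A *ₘ B} A-stable (stable-* {A} {B} A-stable B-stable)

    C₀₁≈0 : C 0F 1F ≈ 0#
    C₀₁≈0 = off-diagonal≈0 2≈0 {C} C-stable (trace-commutator A B) 0F 1F refl

    C₁₀≈0 : C 1F 0F ≈ 0#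
    C₁₀≈0 = off-diagonal≈0 2≈0 {C} C-stable (trace-commutator A B) 1F 0F refl

    E₀₁≈0 : E 0F 1F ≈ 0#
    E₀₁≈0 = off-diagonal≈0 2≈0 {E} E-stable (trace-commutator A (A *ₘ B)) 0F 1F refl

    E₁₀≈0 : E 1F 0F ≈ 0#
    E₁₀≈0 = off-diagonal≈0 2≈0 {E} E-stable (trace-commutator A (A *ₘ B)) 1F 0F refl

    -- The entry of A C at (0, 1) is A₀₀ C₀₁ + A₀₁ C₁₁, and C₁₁ = -C₀₀ for a commutator.
    C₀₀A₀₁≈0 : C 0F 0F * A 0F 1F ≈ 0#
    C₀₀A₀₁≈0 = begin
      C 0F 0F * A 0F 1F            ≈⟨ solve 8 (λ a b c d a′ b′ c′ d′ →
          let A = :matrix a b c d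
              B = :matrix a′ b′ c′ d′
              C = :commutator A B
          in C 0F 0F :* b := a :* C 0F 1F :- :commutator A (A :*ₘ B) 0F 1F) refl
        (A 0F 0F) (A 0F 1F) (A 1F 0F) (A 1F 1F) (B 0F 0F) (B 0F 1F) (B 1F 0F) (B 1F 1F) ⟩
      A 0F 0F * C 0F 1F - E 0F 1F  ≈⟨ +-cong (*-congˡ C₀₁≈0) (-‿cong E₀₁≈0) ⟩
      A 0F 0F * 0# - 0#            ≈⟨ solve 1 (λ x → x :* :0 :- :0 := :0) refl (A 0F 0F) ⟩
      0#                           ∎

    C₀₀A₁₀≈0 : C 0F 0F * A 1F 0F ≈ 0#
    C₀₀A₁₀≈0 = begin
      C 0F 0F * A 1F 0F            ≈⟨ solve 8 (λ a b c d a′ b′ c′ d′ →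
          let A = :matrix a b c d
              B = :matrix a′ b′ c′ d′
              C = :commutator A B
          in C 0F 0F :* c := :commutator A (A :*ₘ B) 1F 0F :- d :* C 1F 0F) refl
        (A 0F 0F) (A 0F 1F) (A 1F 0F) (A 1F 1F) (B 0F 0F) (B 0F 1F) (B 1F 0F) (B 1F 1F) ⟩
      E 1F 0F - A 1F 1F * C 1F 0F  ≈⟨ +-cong E₁₀≈0 (-‿cong (*-congˡ C₁₀≈0)) ⟩
      0# - A 1F 1F * 0#            ≈⟨ solve 1 (λ x → :0 :- x :* :0 := :0) refl (A 1F 1F) ⟩
      0#                           ∎

    -- Otherwise A is diagonal, and a commutator with a diagonal matrix has zero diagonal.
    C₀₀≈0 : C 0F 0F ≈ 0#
    C₀₀≈0 = decidable-stable (C 0F 0F ≟ 0#) λ C₀₀≉0 → C₀₀≉0 (begin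
      C 0F 0F
        ≈⟨ solve 6 (λ a b c a′ b′ c′ → a :* a′ :+ (b :* c′ :+ :0) :- (a′ :* a :+ (b′ :* c :+ :0)) := b :* c′ :- b′ :* c) refl
             (A 0F 0F) (A 0F 1F) (A 1F 0F) (B 0F 0F) (B 0F 1F) (B 1F 0F) ⟩
      A 0F 1F * B 1F 0F - B 0F 1F * A 1F 0F
        ≈⟨ +-cong (*-congʳ (*-nonzero-cancelˡ C₀₀≉0 C₀₀A₀₁≈0)) (-‿cong (*-congˡ (*-nonzero-cancelˡ C₀₀≉0 C₀₀A₁₀≈0))) ⟩
      0# * B 1F 0F - B 0F 1F * 0#
        ≈⟨ solve 2 (λ x y → :0 :* x :- y :* :0 := :0) refl (B 1F 0F) (B 0F 1F) ⟩
      0# ∎)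

    C₁₁≈0 : C 1F 1F ≈ 0#
    C₁₁≈0 = begin
      C 1F 1F             ≈⟨ solve 2 (λ a d → d := a :+ d :- a) refl (C 0F 0F) (C 1F 1F) ⟩
      trace C - C 0F 0F   ≈⟨ +-cong (trace-commutator A B) (-‿cong C₀₀≈0) ⟩
      0# - 0#             ≈⟨ -‿inverseʳ 0# ⟩
      0#                  ∎

  stable-comm : ∀ {A B} → Stable A → Stable B → A *ₘ B ≋ B *ₘ A
  stable-comm {A} {B} A-stable B-stable i j = x∙y⁻¹≈ε⇒x≈y _ _ (commutes (1# + 1# ≟ 0#) i j)
    where
    commutes : Dec (1# + 1# ≈ 0#) → IsZero (commutator A B)
    commutes (yes 2≈0) = commutes-even 2≈0 {A} {B} A-stable B-stable
    commutes (no  2≉0) = commutes-odd 2≉0 {A} {B} A-stable B-stable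

  -- Inverses.

  stable-inverse : ∀ {A} → Stable A → ¬ IsZero A → ∃ λ B → Stable B × A *ₘ B ≋ 1ₘ
  stable-inverse {A} A-stable A≉0 = B , B-stable , A*B≋1
    where
    a = A 0F 0F
    b = A 0F 1F
    d = A 1F 0F
    e = A 1F 1F

    det⁻¹ : ∃ λ t → det A * t ≈ 1#
    det⁻¹ = inverse (det A) (A≉0 ∘ singular-stable⇒zero A A-stable)

    t = proj₁ det⁻¹

    det*t-1≈0 : det A * t - 1# ≈ 0#
    det*t-1≈0 = x≈y⇒x∙y⁻¹≈ε (proj₂ det⁻¹)

    -- The adjugate of A divided by its determinant.
    B : Matrix
    B = (t * e ∷ t * - b ∷ []) ∷ (t * - d ∷ t * a ∷ []) ∷ []

    A*B≋1 : A *ₘ B ≋ 1ₘ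
    A*B≋1 = ⟨
      ⟨ drop-multiple 1# det*t-1≈0 (solve 5 (λ a b d e t → a :* (t :* e) :+ (b :* (t :* :- d) :+ :0) := :1 :+ :1 :* ((a :* e :- b :* d) :* t :- :1)) refl
            a b d e t) ,
        solve 3 (λ a b t → a :* (t :* :- b) :+ (b :* (t :* a) :+ :0) := :0) refl a b t ⟩ ,
      ⟨ solve 3 (λ d e t → d :* (t :* e) :+ (e :* (t :* :- d) :+ :0) := :0) refl d e t ,
        drop-multiple 1# det*t-1≈0 (solve 5 (λ a b d e t → d :* (t :* :- b) :+ (e :* (t :* a) :+ :0) := :1 :+ :1 :* ((a :* e :- b :* d) :* t :- :1)) refl
              a b d e t) ⟩ ⟩

    B-undoes-A₀ : ∀ y → t * e * row A 0F y + t * - b * row A 1F y ≈ y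
    B-undoes-A₀ y = drop-multiple y det*t-1≈0 (solve 7 (λ a b d e t y z →
      t :* e :* (a :* y :+ b :* z) :+ t :* :- b :* (d :* y :+ e :* z) := y :+ y :* ((a :* e :- b :* d) :* t :- :1)) refl a b d e t y (F y))

    B-undoes-A₁ : ∀ y → t * - d * row A 0F y + t * a * row A 1F y ≈ F y
    B-undoes-A₁ y = drop-multiple (F y) det*t-1≈0 (solve 7 (λ a b d e t y z →
      t :* :- d :* (a :* y :+ b :* z) :+ t :* a :* (d :* y :+ e :* z) := z :+ z :* ((a :* e :- b :* d) :* t :- :1)) refl a b d e t y (F y))

    row-injective : ∀ {y z} → row A 0F y ≈ row A 0F z → y ≈ z
    row-injective {y} {z} eq = begin
      y                                                     ≈⟨ B-undoes-A₀ y ⟨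
      t * e * row A 0F y + t * - b * row A 1F y
        ≈⟨ +-cong (*-congˡ eq) (*-congˡ (trans (sym (A-stable y)) (trans (F-cong eq) (A-stable z)))) ⟩
      t * e * row A 0F z + t * - b * row A 1F z             ≈⟨ B-undoes-A₀ z ⟩
      z                                                     ∎

    B-stable : Stable B
    B-stable z =
      -- Every graph point (z, F z) is A (y, F y) for some y, because `row A 0F` is an injective
      -- self-map of a finite set; B therefore sends it back to (y, F y).
      let y , Ay≈z = injective-endo⇒surjective (row A 0F) row-injective z
          Fz≈ = trans (F-cong (sym Ay≈z)) (A-stable y)
      in begin
        F (row B 0F z)                                 ≈⟨ F-cong (+-cong (*-congˡ (sym Ay≈z)) (*-congˡ Fz≈)) ⟩
        F (t * e * row A 0F y + t * - b * row A 1F y)  ≈⟨ F-cong (B-undoes-A₀ y) ⟩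
        F y                                            ≈⟨ B-undoes-A₁ y ⟨
        t * - d * row A 0F y + t * a * row A 1F y      ≈⟨ +-cong (*-congˡ (sym Ay≈z)) (*-congˡ Fz≈) ⟨
        row B 1F z                                     ∎

  -- Matrix ring axioms and the field structure.

  *ₘ-cong : ∀ {A A′ B B′} → A ≋ A′ → B ≋ B′ → A *ₘ B ≋ A′ *ₘ B′
  *ₘ-cong A≋A′ B≋B′ i j = +-cong (*-cong (A≋A′ i 0F) (B≋B′ 0F j)) (+-congʳ (*-cong (A≋A′ i 1F) (B≋B′ 1F j)))

  *ₘ-assoc : ∀ A B C → (A *ₘ B) *ₘ C ≋ A *ₘ (B *ₘ C)
  *ₘ-assoc A B C i j = solve 8 (λ a a′ b₀₀ b₀₁ b₁₀ b₁₁ c c′ →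
      (a :* b₀₀ :+ (a′ :* b₁₀ :+ :0)) :* c :+ ((a :* b₀₁ :+ (a′ :* b₁₁ :+ :0)) :* c′ :+ :0)
      := a :* (b₀₀ :* c :+ (b₀₁ :* c′ :+ :0)) :+ (a′ :* (b₁₀ :* c :+ (b₁₁ :* c′ :+ :0)) :+ :0)) refl
    (A i 0F) (A i 1F) (B 0F 0F) (B 0F 1F) (B 1F 0F) (B 1F 1F) (C 0F j) (C 1F j)

  *ₘ-distribˡ-+ₘ : ∀ A B C → A *ₘ (B +ₘ C) ≋ (A *ₘ B) +ₘ (A *ₘ C)
  *ₘ-distribˡ-+ₘ A B C i j = solve 6 (λ a a′ b b′ c c′ →
      a :* (b :+ c) :+ (a′ :* (b′ :+ c′) :+ :0) := a :* b :+ (a′ :* b′ :+ :0) :+ (a :* c :+ (a′ :* c′ :+ :0))) refl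
    (A i 0F) (A i 1F) (B 0F j) (B 1F j) (C 0F j) (C 1F j)

  *ₘ-distribʳ-+ₘ : ∀ A B C → (B +ₘ C) *ₘ A ≋ (B *ₘ A) +ₘ (C *ₘ A)
  *ₘ-distribʳ-+ₘ A B C i j = solve 6 (λ a a′ b b′ c c′ →
      (b :+ c) :* a :+ ((b′ :+ c′) :* a′ :+ :0) := b :* a :+ (b′ :* a′ :+ :0) :+ (c :* a :+ (c′ :* a′ :+ :0))) refl
    (A 0F j) (A 1F j) (B i 0F) (B i 1F) (C i 0F) (C i 1F)

  *ₘ-identityˡ : ∀ A → 1ₘ *ₘ A ≋ A
  *ₘ-identityˡ A = ⟨
    (λ j → solve 2 (λ a b → :1 :* a :+ (:0 :* b :+ :0) := a) refl (A 0F j) (A 1F j)) ,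
    (λ j → solve 2 (λ a b → :0 :* a :+ (:1 :* b :+ :0) := b) refl (A 0F j) (A 1F j)) ⟩

  *ₘ-identityʳ : ∀ A → A *ₘ 1ₘ ≋ A
  *ₘ-identityʳ A i = ⟨
    solve 2 (λ a b → a :* :1 :+ (b :* :0 :+ :0) := a) refl (A i 0F) (A i 1F) ,
    solve 2 (λ a b → a :* :0 :+ (b :* :1 :+ :0) := b) refl (A i 0F) (A i 1F) ⟩

  stabiliser-isField : SubsetIsField matrixSetoid _+ₘ_ _*ₘ_ Stabilises
  stabiliser-isField = record
    { +-closed = λ A B A∈S B∈S → stable⇒stabilises (A +ₘ B)
        (stable-+ {A} {B} (stabilises⇒stable A A∈S) (stabilises⇒stable B B∈S))
    ; *-closed = λ A B A∈S B∈S → stable⇒stabilises (A *ₘ B)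
        (stable-* {A} {B} (stabilises⇒stable A A∈S) (stabilises⇒stable B B∈S))
    ; neg = λ (A , A∈S) → -ₘ A , stable⇒stabilises (-ₘ A) (stable-neg {A} (stabilises⇒stable A A∈S))
    ; zer = 0ₘ , stable⇒stabilises 0ₘ stable-0
    ; one = 1ₘ , stable⇒stabilises 1ₘ stable-1
    ; isField = record
      { isCommutativeRing = record
        { isRing = record
          { +-isAbelianGroup = record
            { isGroup = record
              { isMonoid = record
                { isSemigroup = record
                  { isMagma = record
                    { isEquivalence = Setoid.isEquivalence (subsetSetoid matrixSetoid Stabilises)
                    ; ∙-cong        = λ A≋A′ B≋B′ i j → +-cong (A≋A′ i j) (B≋B′ i j)
                    }
                  ; assoc = λ (A , _) (B , _) (C , _) i j → +-assoc (A i j) (B i j) (C i j)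
                  }
                ; identity = (λ (A , _) i j → +-identityˡ (A i j)) , (λ (A , _) i j → +-identityʳ (A i j))
                }
              ; inverse = (λ (A , _) i j → -‿inverseˡ (A i j)) , (λ (A , _) i j → -‿inverseʳ (A i j))
              ; ⁻¹-cong = λ A≋B i j → -‿cong (A≋B i j)
              }
            ; comm = λ (A , _) (B , _) i j → +-comm (A i j) (B i j)
            }
          ; *-cong     = λ { {A , _} {A′ , _} {B , _} {B′ , _} → *ₘ-cong {A} {A′} {B} {B′} }
          ; *-assoc    = λ (A , _) (B , _) (C , _) → *ₘ-assoc A B C
          ; *-identity = (λ (A , _) → *ₘ-identityˡ A) , (λ (A , _) → *ₘ-identityʳ A)
          ; distrib    = (λ (A , _) (B , _) (C , _) → *ₘ-distribˡ-+ₘ A B C) , (λ (A , _) (B , _) (C , _) → *ₘ-distribʳ-+ₘ A B C)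
          }
        ; *-comm = λ (A , A∈S) (B , B∈S) → stable-comm {A} {B} (stabilises⇒stable A A∈S) (stabilises⇒stable B B∈S)
        }
      ; 1≉0     = λ 1≋0 → 1≉0 (1≋0 0F 0F)
      ; inverse = λ (A , A∈S) A≉0 →
          let B , B-stable , A*B≋1 = stable-inverse {A} (stabilises⇒stable A A∈S) A≉0
          in (B , stable⇒stabilises B B-stable) , A*B≋1
      }
    }

theorem2p3 : ∀ {c ℓ} (q n : ℕ) → IsPrimePower q → 1 ≤ n → (K : Field c ℓ) →
    let open Geometry K in
    HasCardinality setoid (q ^ n) → (f : QPolynomial n) → LowWeight q f →
    SubsetIsField matrixSetoid _+ₘ_ _*ₘ_ (𝕊 q f)
theorem2p3 q n q-primePower _ K card f lowWeight =
  -- With N taken to be `q ^ n` and F the evaluation of f, `FewPointsOnLines` and `Stabilises`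
  -- unfold to `LowWeight` and `𝕊`.
  Stabiliser.stabiliser-isField K card (Geometry.eval K q f) (eval-cong f) (eval-additive q-primePower ≡.refl f) lowWeight
  where open FiniteField K card
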